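{- For every integer $n\ge 1$ the following identities hold: (i) $\tau(n) = -\frac{91}{600} \sigma_{11}(n) + \frac{691}{600} \sigma_3(n) + \frac{4\cdot 691}{5n}\sum_{m=1}^{n-1}m\,\sigma_3(m)\sigma_7(n-m)$; (ii) $\tau(n) = -\frac{91}{600} \sigma_{11}(n) + \frac{691}{600} \sigma_7(n) + \frac{2\cdot 691}{5n}\sum_{m=1}^{n-1}(n-m)\sigma_3(m)\sigma_7(n-m)$.
   Context: $\tau(n)$ is Ramanujan's tau function, defined by $q\prod_{n\ge 1}(1-q^n)^{24} = \sum_{n\ge 1}\tau(n)q^n$. For $k\ge 1$, $\sigma_k(n)=\sum_{d\mid n} d^k$ (sum over positive divisors of $n$). For $n=1$ the sum $\sum_{m=1}^{n-1}$ is empty and equals $0$. -}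

module Defs where

import Algebra.Properties.Monoid.Sum
open import Data.Bool.Base using (if_then_else_)
open import Data.Fin.Base using (toℕ)
open import Data.Integer.Base as ℤ using (ℤ; 0ℤ; 1ℤ)
import Data.Integer.Properties as ℤ
open import Data.List.Base using (List; map; filter; applyUpTo)
open import Data.Nat.Base as ℕ using (ℕ; zero; suc; _∸_; _^_; _≡ᵇ_; _≤_; _<_; s≤s; z<s; s<s; _≤′_; ≤′-reflexive; ≤′-step)
open import Data.Nat.Divisibility using (_∣?_)
open import Data.Nat.ListAction using (sum)
import Data.Nat.Properties as ℕ
open import Data.Rational.Base using (ℚ; _/_)
open import Relation.Binary.PropositionalEquality using (_≡_; refl; trans; cong; cong₂; module ≡-Reasoning)

open Algebra.Properties.Monoid.Sum ℤ.+-0-monoid using (sum⁺-syntax; sum-syntax; sum-cong-≗; sum-replicate-zero)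

[1⋯_] : ℕ → List ℕ
[1⋯ n ] = applyUpTo suc n

∑[1⋯_] : ℕ → (ℕ → ℕ) → ℕ
∑[1⋯ n ] f = sum (map f [1⋯ n ])

divisors : ℕ → List ℕ
divisors n = filter (_∣? n) [1⋯ n ]

σ : ℕ → ℕ → ℕ
σ k n = sum (map (_^ k) (divisors n))

ℤ→ℚ : ℤ → ℚ
ℤ→ℚ i = i / 1

ℕ→ℚ : ℕ → ℚ
ℕ→ℚ n = ℤ→ℚ (ℤ.+ n)

-- Formal power series in q over ℤ, as coefficient sequences: f n is the
-- coefficient of qⁿ.
PowerSeries : Set
PowerSeries = ℕ → ℤ

infixl 6 _⊟_
infixl 7 _⊛_
infixr 8 _↑_
infix  9 q^_

q^_ : ℕ → PowerSeries
(q^ m) n = if m ≡ᵇ n then 1ℤ else 0ℤ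

_⊟_ : PowerSeries → PowerSeries → PowerSeries
(f ⊟ g) n = f n ℤ.- g n

_⊛_ : PowerSeries → PowerSeries → PowerSeries
(f ⊛ g) n = ∑[ i ≤ n ] (f (toℕ i) ℤ.* g (n ∸ toℕ i))

_↑_ : PowerSeries → ℕ → PowerSeries
f ↑ zero  = q^ 0
f ↑ suc k = f ⊛ (f ↑ k)

∏[1⋯_] : ℕ → (ℕ → PowerSeries) → PowerSeries
∏[1⋯ zero ]  f = q^ 0
∏[1⋯ suc N ] f = f (suc N) ⊛ ∏[1⋯ N ] f

-- The infinite product of f 1, f 2, …, meaningful when f m ≡ 1 modulo qᵐ for
-- every m ≥ 1: then the coefficient of qⁿ is the same in all partial products
-- with at least n factors (see ∏∞-stable), so it is read off the n-th one.
∏∞ : (ℕ → PowerSeries) → PowerSeries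
∏∞ f n = (∏[1⋯ n ] f) n

τ : ℕ → ℤ
τ = q^ 1 ⊛ ∏∞ (λ m → (q^ 0 ⊟ q^ m) ↑ 24)

_≡1mod-q^_ : PowerSeries → ℕ → Set
f ≡1mod-q^ m = ∀ n → n < m → f n ≡ (q^ 0) n

⊛-≡1ˡ : ∀ {f m} g → f ≡1mod-q^ m → ∀ n → n < m → (f ⊛ g) n ≡ g n
⊛-≡1ˡ {f} {m} g f≡1 n n<m = begin
  f 0 ℤ.* g n ℤ.+ ∑[ i < n ] (f (suc (toℕ i)) ℤ.* g (n ∸ suc (toℕ i)))
    ≡⟨ cong₂ ℤ._+_ (cong (ℤ._* g n) (f≡1 0 (ℕ.≤-<-trans ℕ.z≤n n<m))) (sum-cong-≗ λ i →
         cong (ℤ._* g (n ∸ suc (toℕ i))) (f≡1 (suc (toℕ i)) (ℕ.≤-<-trans (toℕ<n i) n<m))) ⟩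
  1ℤ ℤ.* g n ℤ.+ ∑[ i < n ] 0ℤ
    ≡⟨ cong₂ ℤ._+_ (ℤ.*-identityˡ (g n)) (sum-replicate-zero n) ⟩
  g n ℤ.+ 0ℤ
    ≡⟨ ℤ.+-identityʳ (g n) ⟩
  g n ∎
  where
  open ≡-Reasoning
  open import Data.Fin.Properties using (toℕ<n)

↑-≡1 : ∀ {f m} → f ≡1mod-q^ m → ∀ k → (f ↑ k) ≡1mod-q^ m
↑-≡1 f≡1 zero    n n<m = refl
↑-≡1 {f} f≡1 (suc k) n n<m = trans (⊛-≡1ˡ (f ↑ k) f≡1 n n<m) (↑-≡1 f≡1 k n n<m)

∏∞-stable : ∀ f → (∀ m → f (suc m) ≡1mod-q^ suc m) →
            ∀ {n N} → n ≤ N → (∏[1⋯ N ] f) n ≡ ∏∞ f n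
∏∞-stable f f≡1 n≤N = go (ℕ.≤⇒≤′ n≤N)
  where
  go : ∀ {n N} → n ≤′ N → (∏[1⋯ N ] f) n ≡ ∏∞ f n
  go (≤′-reflexive refl)            = refl
  go {n} {suc N} (≤′-step n≤′N) =
    trans (⊛-≡1ˡ (∏[1⋯ N ] f) (f≡1 N) n (s≤s (ℕ.≤′⇒≤ n≤′N))) (go n≤′N)

1-q^-≡1 : ∀ m → (q^ 0 ⊟ q^ m) ≡1mod-q^ m
1-q^-≡1 m n n<m = trans (cong (λ c → (q^ 0) n ℤ.- c) (q^-< n<m)) (ℤ.+-identityʳ ((q^ 0) n))
  where
  q^-< : ∀ {m n} → n < m → (q^ m) n ≡ 0ℤ
  q^-< z<s               = refl
  q^-< (s<s n<m@(s≤s _)) = q^-< n<m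

τ-factor-≡1 : ∀ m → ((q^ 0 ⊟ q^ m) ↑ 24) ≡1mod-q^ m
τ-factor-≡1 m = ↑-≡1 {f = q^ 0 ⊟ q^ m} {m = m} (1-q^-≡1 m) 24

{-# OPTIONS --safe #-}

-- Write D = q d/dq, s k = ∑ σₖ(n) qⁿ and z a = qᵃ / (1 - qᵃ), so that
-- s k = ∑ₐ aᵏ z a.  From z a · z b = z (a + b) · (z a + z b + 1) one gets, for
-- every polynomial g with g(a, b) = g(b, a) and g(a, a + b) = g(b, a + b),
--   ∑ (g(a, b) - g(a, a + b)) z a z b = ∑ g(c, c) z c² - ∑ (∑_{a < c} g(a, c)) z c.
-- Three choices of g yield 3 D E₄ = E₂ E₄ - E₆, E₈ = E₄² and, for the
-- Eisenstein series E₁₂ scaled by 691, D E₁₂ = E₂ E₁₂ - 691 E₆ E₈.  Hence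
-- 691 E₄ E₈ - E₁₂ solves D U = E₂ U, as does the discriminant by logarithmic
-- differentiation of the product.  This equation determines U from its
-- coefficient at q, so 691 E₄ E₈ - E₁₂ = 432000 ∑ τ(n) qⁿ.  Both identities are
-- D of this one, because D (E₄ E₈) = 3 E₈ D E₄ and E₄ D E₈ = 2 E₈ D E₄.

module Submission where

open import Algebra.Bundles using (CommutativeRing; CommutativeSemiring; RawRing)
open import Algebra.Solver.Ring.AlmostCommutativeRing using (fromCommutativeRing; _-Raw-AlmostCommutative⟶_)
open import Data.Bool.Base using (true; false; if_then_else_)
open import Data.Fin.Base using (Fin; zero; suc; toℕ)
open import Data.Fin.Patterns using (0F; 1F)
open import Data.Fin.Properties using (toℕ-inject₁; toℕ-fromℕ; toℕ<n)
open import Data.Integer.Base as ℤ using (ℤ; 0ℤ; 1ℤ; +_)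
import Data.Integer.Properties as ℤ
open import Data.Integer.Tactic.RingSolver using () renaming (solve-∀ to ℤ-solve-∀)
open import Data.List.Base as List using (List; []; _∷_; filter; applyUpTo)
open import Data.Maybe.Base using (map)
open import Data.Nat.Base as ℕ using (ℕ; zero; suc; NonZero; _∸_; _≤_; _<_; s≤s; z≤n; z<s; s<s; s<s⁻¹)
open import Data.Nat.Divisibility using (_∣_; _∣?_; ∣-refl; ∣m+n∣m⇒∣n; ∣m∣n⇒∣m+n; >⇒∤)
open import Data.Nat.Induction using (<-rec)
open import Data.Nat.ListAction using (sum)
import Data.Nat.Properties as ℕ
open import Data.Nat.Properties using (m*n≢0)
open import Data.Product.Base using (_×_; _,_)
open import Data.Vec.Base using ([]; _∷_; lookup)
open import Function.Base using (_∘_)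
open import Function.Bundles using (mk⇔)
open import Relation.Binary.PropositionalEquality as ≡ using (_≡_)
open import Relation.Nullary.Decidable using (yes; no; does; dec⇒maybe; dec-true; dec-false; does-⇔)
open import Defs

-- Since 1/z a + 1 = q^(-a), the rule for z a · z b is the identity q^(-a) q^(-b) = q^(-(a+b)). In
-- modular terms D - E₂ is the Serre derivative in weight 12; its values have weight 14, where E₆ E₈
-- spans, so 691 E₄ E₈ and E₁₂ leave the same error term - 691 E₆ E₈ and their difference leaves
-- none. The constant 432000 is 691 (240 + 480) - 65520, the coefficient of q in that difference.
-- The obstacle is to do without division and infinite sums. Series are compared modulo q^N, where
-- only finitely many z a survive; z a is known through z a = q^a (1 + z a), and an equation x = u +
-- q^a x with a > 0 has one solution; a common factor 720 or 1440 stays on both sides until single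
-- coefficients in ℤ are reached. The algebra takes place in an arbitrary commutative ring with a
-- homomorphism from ℤ, so that the solver sees series as variables only.

-- Finite double sums and the Liouville identity

module RangeSums {c ℓ} (R : CommutativeSemiring c ℓ) where
  open CommutativeSemiring R
  open import Algebra.Properties.Semiring.Sum semiring public
  open import Algebra.Properties.CommutativeSemigroup +-commutativeSemigroup using (interchange; xy∙z≈xz∙y)
  open import Relation.Binary.Reasoning.Setoid setoid

  ∑-cong : ∀ {n} {f g : Fin n → Carrier} → (∀ i → f i ≈ g i) → ∑[ i < n ] f i ≈ ∑[ i < n ] g i
  ∑-cong = sum-cong-≋

  ∑-zero : ∀ {n} {f : Fin n → Carrier} → (∀ i → f i ≈ 0#) → ∑[ i < n ] f i ≈ 0#
  ∑-zero {n} f≈0 = trans (∑-cong f≈0) (sum-replicate-zero n)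

  ∑-last : ∀ n (f : ℕ → Carrier) → ∑[ i ≤ n ] f (toℕ i) ≈ ∑[ i < n ] f (toℕ i) + f n
  ∑-last n f = trans (sum-init-last (λ (i : Fin (suc n)) → f (toℕ i)))
    (+-cong (∑-cong {n} λ i → reflexive (≡.cong f (toℕ-inject₁ i))) (reflexive (≡.cong f (toℕ-fromℕ n))))

  ∑∑-split : ∀ n (f : ℕ → ℕ → Carrier) →
    ∑[ i < n ] ∑[ j < n ] f (toℕ i) (toℕ j) ≈
    ∑[ j < n ] ∑[ i < toℕ j ] f (toℕ i) (toℕ j) + ∑[ j < n ] ∑[ i < toℕ j ] f (toℕ j) (toℕ i) +
    ∑[ j < n ] f (toℕ j) (toℕ j)
  ∑∑-split zero    f = sym (trans (+-identityʳ _) (+-identityʳ _))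
  ∑∑-split (suc n) f = begin
    ∑[ i ≤ n ] ∑[ j ≤ n ] f (toℕ i) (toℕ j)
      ≈⟨ ∑-last n (λ i → ∑[ j ≤ n ] f i (toℕ j)) ⟩
    ∑[ i < n ] ∑[ j ≤ n ] f (toℕ i) (toℕ j) + ∑[ j ≤ n ] f n (toℕ j)
      ≈⟨ +-cong (trans (∑-cong λ (i : Fin n) → ∑-last n (f (toℕ i)))
                       (∑-distrib-+ (λ (i : Fin n) → ∑[ j < n ] f (toℕ i) (toℕ j)) (λ i → f (toℕ i) n)))
                (∑-last n (f n)) ⟩
    (∑[ i < n ] ∑[ j < n ] f (toℕ i) (toℕ j) + col) + (row + f n n)
      ≈⟨ +-congʳ (+-congʳ (∑∑-split n f)) ⟩
    (upper + lower + diagonal + col) + (row + f n n)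
      ≈⟨ +-congʳ (xy∙z≈xz∙y (upper + lower) diagonal col) ⟩
    (upper + lower + col + diagonal) + (row + f n n)
      ≈⟨ interchange (upper + lower + col) diagonal row (f n n) ⟩
    (upper + lower + col + row) + (diagonal + f n n)
      ≈⟨ +-cong (trans (+-congʳ (xy∙z≈xz∙y upper lower col)) (+-assoc (upper + col) lower row)) (sym (∑-last n (λ j → f j j))) ⟩
    ((upper + col) + (lower + row)) + ∑[ j ≤ n ] f (toℕ j) (toℕ j)
      ≈⟨ +-congʳ (+-cong (∑-last n (λ j → ∑[ i < j ] f (toℕ i) j)) (∑-last n (λ j → ∑[ i < j ] f j (toℕ i)))) ⟨
    ∑[ j ≤ n ] ∑[ i < toℕ j ] f (toℕ i) (toℕ j) + ∑[ j ≤ n ] ∑[ i < toℕ j ] f (toℕ j) (toℕ i) +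
      ∑[ j ≤ n ] f (toℕ j) (toℕ j) ∎
    where
    upper    = ∑[ j < n ] ∑[ i < toℕ j ] f (toℕ i) (toℕ j)
    lower    = ∑[ j < n ] ∑[ i < toℕ j ] f (toℕ j) (toℕ i)
    diagonal = ∑[ j < n ] f (toℕ j) (toℕ j)
    col      = ∑[ i < n ] f (toℕ i) n
    row      = ∑[ j < n ] f n (toℕ j)

  -- The substitution j = i + k + 1 maps the square of pairs (i, k) onto all pairs i < j < n and
  -- some with j ≥ n, where `f` vanishes. The induction peels off the row i = 0 and shifts both
  -- indices of `f`.
  ∑∑-shear : ∀ n (f : ℕ → ℕ → Carrier) → (∀ i j → n ≤ j → f i j ≈ 0#) →
    ∑[ i < n ] ∑[ k < n ] f (toℕ i) (suc (toℕ i ℕ.+ toℕ k)) ≈ ∑[ j < n ] ∑[ i < toℕ j ] f (toℕ i) (toℕ j)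
  ∑∑-shear zero    f f≈0 = refl
  ∑∑-shear (suc n) f f≈0 = begin
    ∑[ k ≤ n ] f 0 (suc (toℕ k)) + ∑[ i < n ] ∑[ k ≤ n ] f (suc (toℕ i)) (suc (suc (toℕ i ℕ.+ toℕ k)))
      -- At k = n the second index is at least `suc n`, so the last term of every row is zero.
      ≈⟨ +-cong (shorten 0 (λ k → suc k) (ℕ.≤-refl))
                (∑-cong λ (i : Fin n) → shorten (suc (toℕ i)) (λ k → suc (suc (toℕ i ℕ.+ k)))
                                          (s≤s (ℕ.m≤n⇒m≤1+n (ℕ.m≤n+m n (toℕ i))))) ⟩
    ∑[ k < n ] f 0 (suc (toℕ k)) + ∑[ i < n ] ∑[ k < n ] f (suc (toℕ i)) (suc (suc (toℕ i ℕ.+ toℕ k)))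
      ≈⟨ +-congˡ (∑∑-shear n (λ i j → f (suc i) (suc j)) (λ i j n≤j → f≈0 (suc i) (suc j) (s≤s n≤j))) ⟩
    ∑[ j < n ] f 0 (suc (toℕ j)) + ∑[ j < n ] ∑[ i < toℕ j ] f (suc (toℕ i)) (suc (toℕ j))
      ≈⟨ ∑-distrib-+ (λ (j : Fin n) → f 0 (suc (toℕ j))) (λ j → ∑[ i < toℕ j ] f (suc (toℕ i)) (suc (toℕ j))) ⟨
    ∑[ j < n ] (f 0 (suc (toℕ j)) + ∑[ i < toℕ j ] f (suc (toℕ i)) (suc (toℕ j)))
      -- The new summand `0#` is the empty inner sum at j = 0.
      ≈⟨ +-identityˡ _ ⟨
    0# + ∑[ j < n ] (f 0 (suc (toℕ j)) + ∑[ i < toℕ j ] f (suc (toℕ i)) (suc (toℕ j))) ∎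
    where
    shorten : ∀ i (e : ℕ → ℕ) → suc n ≤ e n → ∑[ k ≤ n ] f i (e (toℕ k)) ≈ ∑[ k < n ] f i (e (toℕ k))
    shorten i e n<e = trans (∑-last n (λ k → f i (e k))) (trans (+-congˡ (f≈0 i (e n) n<e)) (+-identityʳ _))

  -- w i stands for z (suc i), and the indices of g are shifted likewise.
  module _ (n : ℕ) (w : ℕ → Carrier)
    (w*w : ∀ i k → w i * w k ≈ w (suc (i ℕ.+ k)) * (w i + w k + 1#))
    (w≈0 : ∀ i → n ≤ i → w i ≈ 0#)
    (g : ℕ → ℕ → Carrier)
    (g-swap : ∀ i k → g i k ≈ g k i)
    (g-shear : ∀ i k → g i (suc (i ℕ.+ k)) ≈ g k (suc (i ℕ.+ k)))
    where

    open import Algebra.Solver.Ring.NaturalCoefficients.Default R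

    -- The halves i < k and k < i of the square agree by `g-swap`; with the linear term they make up
    -- the sum over i < j of g i j · w j · (2 w i + 1). After j = i + k + 1, symmetry in i and k
    -- replaces 2 w i by w i + w k, and `w*w` applies. Terms are placed so that nothing is
    -- subtracted in the semiring.
    ∑∑-liouville :
      ∑[ i < n ] ∑[ k < n ] (g (toℕ i) (toℕ k) * (w (toℕ i) * w (toℕ k))) +
        ∑[ j < n ] ((∑[ i < toℕ j ] g (toℕ i) (toℕ j)) * w (toℕ j)) ≈
      ∑[ i < n ] ∑[ k < n ] (g (toℕ i) (suc (toℕ i ℕ.+ toℕ k)) * (w (toℕ i) * w (toℕ k))) +
        ∑[ j < n ] (g (toℕ j) (toℕ j) * (w (toℕ j) * w (toℕ j)))
    ∑∑-liouville = begin
      ∑[ i < n ] ∑[ k < n ] (g (toℕ i) (toℕ k) * (w (toℕ i) * w (toℕ k))) + linear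
        ≈⟨ +-congʳ (∑∑-split n (λ i k → g i k * (w i * w k))) ⟩
      upper + ∑[ j < n ] ∑[ i < toℕ j ] (g (toℕ j) (toℕ i) * (w (toℕ j) * w (toℕ i))) + diagonal + linear
        ≈⟨ +-congʳ (+-congʳ (+-congˡ (∑-cong λ (j : Fin n) → ∑-cong λ (i : Fin (toℕ j)) →
             *-cong (g-swap (toℕ j) (toℕ i)) (*-comm (w (toℕ j)) (w (toℕ i)))))) ⟩
      upper + upper + diagonal + linear
        ≈⟨ solve 3 (λ x y z → x :+ x :+ y :+ z := (x :+ x :+ z) :+ y) refl upper diagonal linear ⟩
      (upper + upper + linear) + diagonal
        ≈⟨ +-congʳ (+-cong (sym (∑-distrib-+ {n} _ _)) (∑-cong λ (j : Fin n) → *-distribʳ-sum (w (toℕ j)) (λ (i : Fin (toℕ j)) → g (toℕ i) (toℕ j)))) ⟩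
      (∑[ j < n ] (col j + col j) + ∑[ j < n ] ∑[ i < toℕ j ] (g (toℕ i) (toℕ j) * w (toℕ j))) + diagonal
        ≈⟨ +-congʳ (trans (sym (∑-distrib-+ {n} _ _)) (∑-cong λ (j : Fin n) →
             trans (+-congʳ (sym (∑-distrib-+ {toℕ j} _ _))) (trans (sym (∑-distrib-+ {toℕ j} _ _)) (∑-cong λ (i : Fin (toℕ j)) →
               solve 3 (λ x a b → x :* (a :* b) :+ x :* (a :* b) :+ x :* b := x :* (b :* (a :+ a :+ con 1))) refl
                 (g (toℕ i) (toℕ j)) (w (toℕ i)) (w (toℕ j)))))) ⟩
      ∑[ j < n ] ∑[ i < toℕ j ] f (toℕ i) (toℕ j) + diagonal
        ≈⟨ +-congʳ (∑∑-shear n f (λ i j n≤j → trans (*-congˡ (trans (*-congʳ (w≈0 j n≤j)) (zeroˡ _))) (zeroʳ _))) ⟨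
      ∑[ i < n ] ∑[ k < n ] f (toℕ i) (suc (toℕ i ℕ.+ toℕ k)) + diagonal
        ≈⟨ +-congʳ symmetrise ⟩
      ∑[ i < n ] ∑[ k < n ] (g (toℕ i) (suc (toℕ i ℕ.+ toℕ k)) * (w (toℕ i) * w (toℕ k))) + diagonal ∎
      where
      linear   = ∑[ j < n ] ((∑[ i < toℕ j ] g (toℕ i) (toℕ j)) * w (toℕ j))
      diagonal = ∑[ j < n ] (g (toℕ j) (toℕ j) * (w (toℕ j) * w (toℕ j)))
      col : Fin n → Carrier
      col j    = ∑[ i < toℕ j ] (g (toℕ i) (toℕ j) * (w (toℕ i) * w (toℕ j)))
      upper    = ∑[ j < n ] col j
      f h e : ℕ → ℕ → Carrier
      f i j    = g i j * (w j * (w i + w i + 1#))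
      h i k    = g i (suc (i ℕ.+ k)) * (w (suc (i ℕ.+ k)) * w i)
      e i k    = g i (suc (i ℕ.+ k)) * (w (suc (i ℕ.+ k)) * (w i + 1#))

      h-swap : ∀ i k → h i k ≈ g k (suc (k ℕ.+ i)) * (w (suc (k ℕ.+ i)) * w i)
      h-swap i k = trans (*-congʳ (g-shear i k))
        (reflexive (≡.cong (λ s → g k (suc s) * (w (suc s) * w i)) (ℕ.+-comm i k)))

      -- One of the two copies of w i is split off as `h` and transposed; it becomes w k, while
      -- `g-shear` keeps its coefficient.
      symmetrise : ∑[ i < n ] ∑[ k < n ] f (toℕ i) (suc (toℕ i ℕ.+ toℕ k)) ≈
                   ∑[ i < n ] ∑[ k < n ] (g (toℕ i) (suc (toℕ i ℕ.+ toℕ k)) * (w (toℕ i) * w (toℕ k)))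
      symmetrise = begin
        ∑[ i < n ] ∑[ k < n ] f (toℕ i) (suc (toℕ i ℕ.+ toℕ k))
          ≈⟨ ∑-cong (λ (i : Fin n) → trans (∑-cong λ (k : Fin n) →
               solve 3 (λ x b a → x :* (b :* (a :+ a :+ con 1)) := x :* (b :* (a :+ con 1)) :+ x :* (b :* a)) refl
                 (g (toℕ i) (suc (toℕ i ℕ.+ toℕ k))) (w (suc (toℕ i ℕ.+ toℕ k))) (w (toℕ i)))
               (∑-distrib-+ {n} _ _)) ⟩
        ∑[ i < n ] (∑[ k < n ] e (toℕ i) (toℕ k) + ∑[ k < n ] h (toℕ i) (toℕ k))
          ≈⟨ ∑-distrib-+ {n} _ _ ⟩
        ∑[ i < n ] ∑[ k < n ] e (toℕ i) (toℕ k) + ∑[ i < n ] ∑[ k < n ] h (toℕ i) (toℕ k)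
          ≈⟨ +-congˡ (∑-comm {n} {n} _) ⟩
        ∑[ i < n ] ∑[ k < n ] e (toℕ i) (toℕ k) + ∑[ i < n ] ∑[ k < n ] h (toℕ k) (toℕ i)
          ≈⟨ ∑-distrib-+ {n} _ _ ⟨
        ∑[ i < n ] (∑[ k < n ] e (toℕ i) (toℕ k) + ∑[ k < n ] h (toℕ k) (toℕ i))
          ≈⟨ ∑-cong (λ (i : Fin n) → trans (sym (∑-distrib-+ {n} _ _)) (∑-cong λ (k : Fin n) →
               trans (+-congˡ (h-swap (toℕ k) (toℕ i)))
               (trans (solve 4 (λ x b a a′ → x :* (b :* (a :+ con 1)) :+ x :* (b :* a′) := x :* (b :* (a :+ a′ :+ con 1))) refl
                 (g (toℕ i) (suc (toℕ i ℕ.+ toℕ k))) (w (suc (toℕ i ℕ.+ toℕ k))) (w (toℕ i)) (w (toℕ k)))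
               (*-congˡ (sym (w*w (toℕ i) (toℕ k))))))) ⟩
        ∑[ i < n ] ∑[ k < n ] (g (toℕ i) (suc (toℕ i ℕ.+ toℕ k)) * (w (toℕ i) * w (toℕ k))) ∎

-- Convolution relations between divisor sums

ℤ-rawRing : RawRing _ _
ℤ-rawRing = CommutativeRing.rawRing ℤ.+-*-commutativeRing

module ℤ-Solver {c ℓ} (R : CommutativeRing c ℓ) (hom : ℤ-rawRing -Raw-AlmostCommutative⟶ fromCommutativeRing R) where
  open CommutativeRing R
  open import Algebra.Solver.Ring ℤ-rawRing (fromCommutativeRing R) hom
    (λ a b → map (λ a≡b → reflexive (≡.cong (_-Raw-AlmostCommutative⟶_.⟦_⟧ hom) a≡b)) (dec⇒maybe (a ℤ.≟ b))) public

  infix 10 #_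

  #_ : ∀ {m} → ℕ → Polynomial m
  # a = con (+ a)

module Relations {c ℓ} (R : CommutativeRing c ℓ) (hom : ℤ-rawRing -Raw-AlmostCommutative⟶ fromCommutativeRing R) where
  open CommutativeRing R
  open _-Raw-AlmostCommutative⟶_ hom renaming (⟦_⟧ to κ)
  open ℤ-Solver R hom
  open RangeSums commutativeSemiring
  open import Algebra.Properties.Semiring.Exp semiring using (_^_; ^-congˡ)
  open import Algebra.Properties.Ring ring using (+-cancelˡ; +-cancelʳ)
  open import Relation.Binary.Reasoning.Setoid setoid

  -- `κ` is additive only up to `≈`, so `ν (suc (i + k))` has to be exchanged for `ν i + ν k` inside
  -- evaluated polynomials.
  ⟦⟧-cong : ∀ {n} (p : Polynomial n) {ρ ρ′} → (∀ i → lookup ρ i ≈ lookup ρ′ i) → ⟦ p ⟧ ρ ≈ ⟦ p ⟧ ρ′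
  ⟦⟧-cong (op [+] p q) ρ≈ = +-cong (⟦⟧-cong p ρ≈) (⟦⟧-cong q ρ≈)
  ⟦⟧-cong (op [*] p q) ρ≈ = *-cong (⟦⟧-cong p ρ≈) (⟦⟧-cong q ρ≈)
  ⟦⟧-cong (con c)      ρ≈ = refl
  ⟦⟧-cong (var x)      ρ≈ = ρ≈ x
  ⟦⟧-cong (p :^ n)     ρ≈ = ^-congˡ n (⟦⟧-cong p ρ≈)
  ⟦⟧-cong (:- p)       ρ≈ = -‿cong (⟦⟧-cong p ρ≈)

  ⟦_⟧₂ : Polynomial 2 → Carrier → Carrier → Carrier
  ⟦ p ⟧₂ a b = ⟦ p ⟧ (a ∷ b ∷ [])

  ⟦_⟧₂-cong : ∀ (p : Polynomial 2) {a a′ b b′} → a ≈ a′ → b ≈ b′ → ⟦ p ⟧₂ a b ≈ ⟦ p ⟧₂ a′ b′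
  ⟦ p ⟧₂-cong a≈a′ b≈b′ = ⟦⟧-cong p λ where
    0F → a≈a′
    1F → b≈b′

  -- e₂ and e₃² are, up to sign, the symmetric functions of a, - b, b - a, which
  -- g(a, b) = g(b, a) and g(a, a + b) = g(b, a + b) only permute (up to a common
  -- sign).  G₄ isolates the product s 1 · s 3, G₆ the square s 3 · s 3, and the
  -- coefficients of G₁₂ are chosen so that s 3 · s 9 drops out while s 1 · s 11
  -- and s 5 · s 7 appear as they do in E₂ E₁₂ - 691 E₆ E₈.  T x c is the sum of
  -- G a c over 0 < a ≤ x, times 30, 30 and 2 respectively.
  e₂ e₃² G₄ G₆ G₁₂ T₄ T₆ T₁₂ : ∀ {m} → Polynomial m → Polynomial m → Polynomial m
  e₂  a b = a :^ 2 :- a :* b :+ b :^ 2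
  e₃² a b = (a :* b :* (a :- b)) :^ 2
  G₄  a b = e₂ a b :^ 2
  G₆  a b = e₃² a b
  G₁₂ a b = :- # 2730 :* e₂ a b :^ 6 :+ # 27300 :* e₂ a b :^ 3 :* e₃² a b :+ # 371175 :* e₃² a b :^ 2
  T₄ x c =
    x :* (:- # 1 :+ # 15 :* c :^ 2 :- # 30 :* c :^ 3 :+ # 30 :* c :^ 4)
      :+ x :^ 2 :* (:- # 15 :* c :+ # 45 :* c :^ 2 :- # 30 :* c :^ 3)
      :+ x :^ 3 :* (# 10 :- # 30 :* c :+ # 30 :* c :^ 2)
      :+ x :^ 4 :* (# 15 :- # 15 :* c)
      :+ x :^ 5 :* (# 6)
  T₆ x c =
    x :* (:- # 1 :* c :^ 2 :+ # 5 :* c :^ 4)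
      :+ x :^ 2 :* (:- # 15 :* c :^ 3 :+ # 15 :* c :^ 4)
      :+ x :^ 3 :* (# 10 :* c :^ 2 :- # 30 :* c :^ 3 :+ # 10 :* c :^ 4)
      :+ x :^ 4 :* (# 15 :* c :^ 2 :- # 15 :* c :^ 3)
      :+ x :^ 5 :* (# 6 :* c :^ 2)
  T₁₂ x c =
    x :* (# 1382 :- # 4550 :* c :^ 2 :- # 32025 :* c :^ 4 :+ # 121520 :* c :^ 6
            :- # 32025 :* c :^ 8 :- # 10010 :* c :^ 10 :+ # 16380 :* c :^ 11 :- # 5460 :* c :^ 12)
      :+ x :^ 2 :* (# 13650 :* c :- # 290220 :* c :^ 5 :+ # 290220 :* c :^ 7
            :- # 30030 :* c :^ 10 :+ # 16380 :* c :^ 11)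
      :+ x :^ 3 :* (:- # 9100 :+ # 30030 :* c :^ 2 :+ # 213500 :* c :^ 4 :- # 850640 :* c :^ 6
            :+ # 320250 :* c :^ 8 :- # 20020 :* c :^ 10)
      :+ x :^ 4 :* (:- # 45045 :* c :+ # 1015770 :* c :^ 5 :- # 1451100 :* c :^ 7
            :+ # 480375 :* c :^ 8)
      :+ x :^ 5 :* (# 18018 :- # 60060 :* c :^ 2 :- # 448350 :* c :^ 4 :+ # 2551920 :* c :^ 6
            :- # 1741320 :* c :^ 7 :+ # 192150 :* c :^ 8)
      :+ x :^ 6 :* (# 60060 :* c :- # 2031540 :* c :^ 5 :+ # 2551920 :* c :^ 6
            :- # 580440 :* c :^ 7)
      :+ x :^ 7 :* (:- # 17160 :+ # 60060 :* c :^ 2 :+ # 640500 :* c :^ 4 :- # 1741320 :* c :^ 5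
            :+ # 729120 :* c :^ 6)
      :+ x :^ 8 :* (:- # 45045 :* c :+ # 480375 :* c :^ 4 :- # 435330 :* c :^ 5)
      :+ x :^ 9 :* (# 10010 :- # 50050 :* c :^ 2 :+ # 106750 :* c :^ 4)
      :+ x :^ 10 :* (# 30030 :* c :- # 30030 :* c :^ 2)
      :+ x :^ 11 :* (:- # 5460 :+ # 16380 :* c :- # 5460 :* c :^ 2)
      :+ x :^ 12 :* (:- # 2730 :+ # 2730 :* c)
      :+ x :^ 13 :* (:- # 420)

  -- One list of coefficients is read at the powers of a ring element, where the solver can check it
  -- through `linearₚ`, and again at the series `s`, where it is part of the conclusion. The same
  -- holds for `bilinear`.
  linear : List (ℤ × ℕ) → (ℕ → Carrier) → Carrier
  linear []             f = κ (+ 0)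
  linear ((c , k) ∷ ls) f = κ c * f k + linear ls f

  bilinear : List (ℤ × ℕ × ℕ) → (ℕ → Carrier) → (ℕ → Carrier) → Carrier
  bilinear []                 f g = κ (+ 0)
  bilinear ((c , k , l) ∷ bs) f g = κ c * (f k * g l) + bilinear bs f g

  linearₚ : ∀ {m} → List (ℤ × ℕ) → (ℕ → Polynomial m) → Polynomial m
  linearₚ []             f = # 0
  linearₚ ((c , k) ∷ ls) f = con c :* f k :+ linearₚ ls f

  bilinearₚ : ∀ {m} → List (ℤ × ℕ × ℕ) → (ℕ → Polynomial m) → (ℕ → Polynomial m) → Polynomial m
  bilinearₚ []                 f g = # 0
  bilinearₚ ((c , k , l) ∷ bs) f g = con c :* (f k :* g l) :+ bilinearₚ bs f g

  ν : ℕ → Carrier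
  ν i = κ (+ suc i)

  -- w and w′ stand for z and D z at suc i, s and s′ for the series ∑ σₖ(n) qⁿ
  -- and their derivatives.
  module LambertSeries (n : ℕ) (w w′ : ℕ → Carrier)
    (w*w : ∀ i k → w i * w k ≈ w (suc (i ℕ.+ k)) * (w i + w k + 1#))
    (w≈0 : ∀ i → n ≤ i → w i ≈ 0#)
    (w′≈ : ∀ i → w′ i ≈ ν i * (w i + w i * w i))
    (s s′ : ℕ → Carrier)
    (s≈  : ∀ k → s  k ≈ ∑[ i < n ] (ν (toℕ i) ^ k * w  (toℕ i)))
    (s′≈ : ∀ k → s′ k ≈ ∑[ i < n ] (ν (toℕ i) ^ k * w′ (toℕ i)))
    where

    ∑-linear : ∀ ps → ∑[ i < n ] (linear ps (ν (toℕ i) ^_) * w (toℕ i)) ≈ linear ps s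
    ∑-linear []             = trans (∑-zero {n} λ i → trans (*-congʳ 0-homo) (zeroˡ (w (toℕ i)))) (sym 0-homo)
    ∑-linear ((c , k) ∷ ps) = begin
      ∑[ i < n ] ((κ c * ν (toℕ i) ^ k + linear ps (ν (toℕ i) ^_)) * w (toℕ i))
        ≈⟨ ∑-cong {n} (λ i → trans (distribʳ _ _ _) (+-congʳ (*-assoc _ _ _))) ⟩
      ∑[ i < n ] (κ c * (ν (toℕ i) ^ k * w (toℕ i)) + linear ps (ν (toℕ i) ^_) * w (toℕ i))
        ≈⟨ ∑-distrib-+ {n} _ _ ⟩
      ∑[ i < n ] (κ c * (ν (toℕ i) ^ k * w (toℕ i))) + ∑[ i < n ] (linear ps (ν (toℕ i) ^_) * w (toℕ i))
        ≈⟨ +-cong (trans (sym (*-distribˡ-sum {n} (κ c) _)) (*-congˡ (sym (s≈ k)))) (∑-linear ps) ⟩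
      κ c * s k + linear ps s ∎

    ∑∑-bilinear : ∀ ps →
      ∑[ i < n ] ∑[ j < n ] (bilinear ps (ν (toℕ i) ^_) (ν (toℕ j) ^_) * (w (toℕ i) * w (toℕ j))) ≈ bilinear ps s s
    ∑∑-bilinear []                 = trans
      (∑-zero {n} λ i → ∑-zero {n} λ j → trans (*-congʳ 0-homo) (zeroˡ (w (toℕ i) * w (toℕ j)))) (sym 0-homo)
    ∑∑-bilinear ((c , k , l) ∷ ps) = begin
      ∑[ i < n ] ∑[ j < n ] ((κ c * (ν (toℕ i) ^ k * ν (toℕ j) ^ l) + bilinear ps (ν (toℕ i) ^_) (ν (toℕ j) ^_)) * (w (toℕ i) * w (toℕ j)))
        ≈⟨ ∑-cong {n} (λ i → trans (∑-cong {n} λ j → distribʳ _ _ _) (∑-distrib-+ {n} _ _)) ⟩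
      ∑[ i < n ] (∑[ j < n ] (κ c * (ν (toℕ i) ^ k * ν (toℕ j) ^ l) * (w (toℕ i) * w (toℕ j))) +
                  ∑[ j < n ] (bilinear ps (ν (toℕ i) ^_) (ν (toℕ j) ^_) * (w (toℕ i) * w (toℕ j))))
        ≈⟨ ∑-distrib-+ {n} _ _ ⟩
      ∑[ i < n ] ∑[ j < n ] (κ c * (ν (toℕ i) ^ k * ν (toℕ j) ^ l) * (w (toℕ i) * w (toℕ j))) +
      ∑[ i < n ] ∑[ j < n ] (bilinear ps (ν (toℕ i) ^_) (ν (toℕ j) ^_) * (w (toℕ i) * w (toℕ j)))
        ≈⟨ +-cong (∑-cong {n} λ i → trans (∑-cong {n} λ j →
             solve 5 (λ c x y u v → c :* (x :* y) :* (u :* v) := c :* (x :* u) :* (y :* v)) refl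
               (κ c) (ν (toℕ i) ^ k) (ν (toℕ j) ^ l) (w (toℕ i)) (w (toℕ j)))
             (trans (sym (*-distribˡ-sum {n} (κ c * (ν (toℕ i) ^ k * w (toℕ i))) _)) (*-congˡ (sym (s≈ l)))))
             (∑∑-bilinear ps) ⟩
      ∑[ i < n ] (κ c * (ν (toℕ i) ^ k * w (toℕ i)) * s l) + bilinear ps s s
        ≈⟨ +-congʳ (trans (sym (*-distribʳ-sum {n} (s l) _)) (*-congʳ (trans (sym (*-distribˡ-sum {n} (κ c) _)) (*-congˡ (sym (s≈ k)))))) ⟩
      κ c * s k * s l + bilinear ps s s
        ≈⟨ +-congʳ (*-assoc (κ c) (s k) (s l)) ⟩
      κ c * (s k * s l) + bilinear ps s s ∎

    -- Each hypothesis is a polynomial identity within reach of the solver. `T-zero` and `T-step`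
    -- make `T` a discrete antiderivative of K · G in the first argument (Faulhaber's formula), with
    -- `K` clearing denominators; `T-linear` evaluates it at x = c - 1.
    module _ (G T : Polynomial 2) (K γ : ℤ) (d : ℕ) (ls : List (ℤ × ℕ)) (bs : List (ℤ × ℕ × ℕ))
      (G-swap     : ∀ a b → ⟦ G ⟧₂ a b ≈ ⟦ G ⟧₂ b a)
      (G-shear    : ∀ a b → ⟦ G ⟧₂ a (a + b) ≈ ⟦ G ⟧₂ b (a + b))
      (G-bilinear : ∀ a b → ⟦ G ⟧₂ a b ≈ ⟦ G ⟧₂ a (a + b) + bilinear bs (a ^_) (b ^_))
      (G-diagonal : ∀ a → ⟦ G ⟧₂ a a ≈ κ γ * a ^ suc d)
      (T-zero     : ∀ a → ⟦ T ⟧₂ (κ (+ 0)) a ≈ κ (+ 0))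
      (T-step     : ∀ x a → ⟦ T ⟧₂ (κ (+ 1) + x) a ≈ ⟦ T ⟧₂ x a + κ K * ⟦ G ⟧₂ (κ (+ 1) + x) a)
      (T-linear   : ∀ x → ⟦ T ⟧₂ x (κ (+ 1) + x) ≈ linear ls ((κ (+ 1) + x) ^_))
      where

      private
        g : ℕ → ℕ → Carrier
        g i k = ⟦ G ⟧₂ (ν i) (ν k)

        ν-+ : ∀ i k → ν (suc (i ℕ.+ k)) ≈ ν i + ν k
        ν-+ i k = trans (reflexive (≡.cong (λ m → κ (+ suc m)) (≡.sym (ℕ.+-suc i k)))) (+-homo (+ suc i) (+ suc k))

        linear-cong : ∀ ps {a b} → a ≈ b → linear ps (a ^_) ≈ linear ps (b ^_)
        linear-cong []             a≈b = refl
        linear-cong ((c , k) ∷ ps) a≈b = +-cong (*-congˡ (^-congˡ k a≈b)) (linear-cong ps a≈b)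

        g-shear : ∀ i k → g i (suc (i ℕ.+ k)) ≈ g k (suc (i ℕ.+ k))
        g-shear i k = trans (⟦ G ⟧₂-cong refl (ν-+ i k))
          (trans (G-shear (ν i) (ν k)) (⟦ G ⟧₂-cong refl (sym (ν-+ i k))))

        g-bilinear : ∀ i k → g i k ≈ g i (suc (i ℕ.+ k)) + bilinear bs (ν i ^_) (ν k ^_)
        g-bilinear i k = trans (G-bilinear (ν i) (ν k)) (+-congʳ (⟦ G ⟧₂-cong refl (sym (ν-+ i k))))

        ∑g : ∀ m a → κ K * (∑[ i < m ] ⟦ G ⟧₂ (ν (toℕ i)) a) ≈ ⟦ T ⟧₂ (κ (+ m)) a
        ∑g zero    a = trans (zeroʳ _) (sym (trans (T-zero a) 0-homo))
        ∑g (suc m) a = begin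
          κ K * (∑[ i ≤ m ] ⟦ G ⟧₂ (ν (toℕ i)) a)
            ≈⟨ *-congˡ (∑-last m (λ i → ⟦ G ⟧₂ (ν i) a)) ⟩
          κ K * (∑[ i < m ] ⟦ G ⟧₂ (ν (toℕ i)) a + ⟦ G ⟧₂ (ν m) a)
            ≈⟨ trans (distribˡ _ _ _) (+-cong (∑g m a) (*-congˡ (⟦ G ⟧₂-cong (+-homo (+ 1) (+ m)) refl))) ⟩
          ⟦ T ⟧₂ (κ (+ m)) a + κ K * ⟦ G ⟧₂ (κ (+ 1) + κ (+ m)) a
            ≈⟨ T-step (κ (+ m)) a ⟨
          ⟦ T ⟧₂ (κ (+ 1) + κ (+ m)) a
            ≈⟨ ⟦ T ⟧₂-cong (sym (+-homo (+ 1) (+ m))) refl ⟩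
          ⟦ T ⟧₂ (κ (+ suc m)) a ∎

        ∑g-linear : ∀ m → κ K * (∑[ i < m ] g (toℕ i) m) ≈ linear ls (ν m ^_)
        ∑g-linear m = begin
          κ K * (∑[ i < m ] g (toℕ i) m)         ≈⟨ ∑g m (ν m) ⟩
          ⟦ T ⟧₂ (κ (+ m)) (ν m)                 ≈⟨ ⟦ T ⟧₂-cong refl (+-homo (+ 1) (+ m)) ⟩
          ⟦ T ⟧₂ (κ (+ m)) (κ (+ 1) + κ (+ m))   ≈⟨ T-linear (κ (+ m)) ⟩
          linear ls ((κ (+ 1) + κ (+ m)) ^_)          ≈⟨ linear-cong ls (+-homo (+ 1) (+ m)) ⟨
          linear ls (ν m ^_)                        ∎

        sheared diagonal lines : Carrier
        sheared  = ∑[ i < n ] ∑[ k < n ] (g (toℕ i) (suc (toℕ i ℕ.+ toℕ k)) * (w (toℕ i) * w (toℕ k)))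
        diagonal = ∑[ j < n ] (g (toℕ j) (toℕ j) * (w (toℕ j) * w (toℕ j)))
        lines    = ∑[ j < n ] ((∑[ i < toℕ j ] g (toℕ i) (toℕ j)) * w (toℕ j))

        -- Adding `sheared` turns the bilinear part back into the double sum of `g i k`, which is
        -- how `∑∑-liouville` states it.
        bilinear-relation : bilinear bs s s + lines ≈ diagonal
        bilinear-relation = +-cancelˡ sheared _ _ (begin
          sheared + (bilinear bs s s + lines)
            ≈⟨ +-assoc _ _ _ ⟨
          sheared + bilinear bs s s + lines
            ≈⟨ +-congʳ (+-congˡ (∑∑-bilinear bs)) ⟨
          sheared + (∑[ i < n ] ∑[ k < n ] (bilinear bs (ν (toℕ i) ^_) (ν (toℕ k) ^_) * (w (toℕ i) * w (toℕ k)))) + lines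
            ≈⟨ +-congʳ (∑-distrib-+ {n} _ _) ⟨
          (∑[ i < n ] (∑[ k < n ] (g (toℕ i) (suc (toℕ i ℕ.+ toℕ k)) * (w (toℕ i) * w (toℕ k))) +
                      ∑[ k < n ] (bilinear bs (ν (toℕ i) ^_) (ν (toℕ k) ^_) * (w (toℕ i) * w (toℕ k))))) + lines
            ≈⟨ +-congʳ (∑-cong {n} λ i → trans (sym (∑-distrib-+ {n} _ _)) (∑-cong {n} λ k →
                 trans (sym (distribʳ _ _ _)) (*-congʳ (sym (g-bilinear (toℕ i) (toℕ k)))))) ⟩
          ∑[ i < n ] ∑[ k < n ] (g (toℕ i) (toℕ k) * (w (toℕ i) * w (toℕ k))) + lines
            ≈⟨ ∑∑-liouville n w w*w w≈0 g (λ i k → G-swap (ν i) (ν k)) g-shear ⟩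
          sheared + diagonal ∎)

        lines-linear : κ K * lines ≈ linear ls s
        lines-linear = begin
          κ K * lines
            ≈⟨ *-distribˡ-sum {n} (κ K) _ ⟩
          ∑[ j < n ] (κ K * ((∑[ i < toℕ j ] g (toℕ i) (toℕ j)) * w (toℕ j)))
            ≈⟨ ∑-cong {n} (λ j → trans (sym (*-assoc _ _ _)) (*-congʳ (∑g-linear (toℕ j)))) ⟩
          ∑[ j < n ] (linear ls (ν (toℕ j) ^_) * w (toℕ j))
            ≈⟨ ∑-linear ls ⟩
          linear ls s ∎

        -- By `w′≈` the square ν · w · w is w′ minus ν · w, so the diagonal is where derivatives
        -- enter.
        diagonal-derivative : diagonal + κ γ * s (suc d) ≈ κ γ * s′ d
        diagonal-derivative = begin
          diagonal + κ γ * s (suc d)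
            ≈⟨ trans (+-congˡ (trans (*-congˡ (s≈ (suc d))) (*-distribˡ-sum {n} (κ γ) _))) (sym (∑-distrib-+ {n} _ _)) ⟩
          ∑[ j < n ] (g (toℕ j) (toℕ j) * (w (toℕ j) * w (toℕ j)) + κ γ * (ν (toℕ j) ^ suc d * w (toℕ j)))
            ≈⟨ ∑-cong {n} (λ j → trans (+-congʳ (*-congʳ (G-diagonal (ν (toℕ j)))))
                 (trans (solve 4 (λ c v p x → c :* (v :* p) :* (x :* x) :+ c :* (v :* p :* x) := c :* (p :* (v :* (x :+ x :* x)))) refl
                   (κ γ) (ν (toℕ j)) (ν (toℕ j) ^ d) (w (toℕ j)))
                 (*-congˡ (*-congˡ (sym (w′≈ (toℕ j))))))) ⟩
          ∑[ j < n ] (κ γ * (ν (toℕ j) ^ d * w′ (toℕ j)))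
            ≈⟨ trans (*-congˡ (s′≈ d)) (*-distribˡ-sum {n} (κ γ) _) ⟨
          κ γ * s′ d ∎

      convolution-relation : κ K * bilinear bs s s + linear ls s + κ K * (κ γ * s (suc d)) ≈ κ K * (κ γ * s′ d)
      convolution-relation = begin
        κ K * bilinear bs s s + linear ls s + κ K * (κ γ * s (suc d))
          ≈⟨ +-congʳ (trans (+-congˡ (sym lines-linear)) (sym (distribˡ _ _ _))) ⟩
        κ K * (bilinear bs s s + lines) + κ K * (κ γ * s (suc d))
          ≈⟨ +-congʳ (*-congˡ bilinear-relation) ⟩
        κ K * diagonal + κ K * (κ γ * s (suc d))
          ≈⟨ trans (sym (distribˡ _ _ _)) (*-congˡ diagonal-derivative) ⟩
        κ K * (κ γ * s′ d) ∎

    E₂ E₄ E₆ E₈ E₁₂ : Carrier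
    E₂  = κ (+ 1) - κ (+ 24) * s 1
    E₄  = κ (+ 1) + κ (+ 240) * s 3
    E₆  = κ (+ 1) - κ (+ 504) * s 5
    E₈  = κ (+ 1) + κ (+ 480) * s 7
    E₁₂ = κ (+ 691) + κ (+ 65520) * s 11

    private
      -- Each Eisenstein relation below is a multiple of a `convolution-relation` up to a ring
      -- identity, which `eq` carries. The multipliers -24, 480 and 12 are those that cancel the
      -- products of two series.
      cross : ∀ {x y l r} → l ≈ r → x + r ≈ y + l → x ≈ y
      cross {x} {y} {l} {r} l≈r eq = +-cancelʳ r x y (trans eq (+-congˡ l≈r))

    -- Ramanujan's equation for E₄. The term - 30 s 4 of the Faulhaber sum cancels the 30 s 4 left
    -- by the diagonal.
    E₄-derivative : κ (+ 3) * (κ (+ 240) * s′ 3) ≈ E₂ * E₄ - E₆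
    E₄-derivative = cross (*-congˡ {κ (ℤ.- + 24)} relation)
      (solve 5 (λ s₁ s₃ s₄ s₅ t → # 3 :* (# 240 :* t) :+ con (ℤ.- + 24) :* (# 30 :* (# 1 :* t))
        := (# 1 :- # 24 :* s₁) :* (# 1 :+ # 240 :* s₃) :- (# 1 :- # 504 :* s₅) :+
           con (ℤ.- + 24) :* (# 30 :* (con (ℤ.- + 4) :* (s₁ :* s₃) :+ (con (ℤ.- + 4) :* (s₃ :* s₁) :+ # 0)) :+
             (con (ℤ.- + 1) :* s₁ :+ (# 10 :* s₃ :+ (con (ℤ.- + 30) :* s₄ :+ (# 21 :* s₅ :+ # 0)))) :+
             # 30 :* (# 1 :* s₄)))
        refl (s 1) (s 3) (s 4) (s 5) (s′ 3))
      where
      ls = (ℤ.- + 1 , 1) ∷ (+ 10 , 3) ∷ (ℤ.- + 30 , 4) ∷ (+ 21 , 5) ∷ []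
      bs = (ℤ.- + 4 , 1 , 3) ∷ (ℤ.- + 4 , 3 , 1) ∷ []
      relation = convolution-relation (G₄ (var 0F) (var 1F)) (T₄ (var 0F) (var 1F)) (+ 30) (+ 1) 3 ls bs
        (solve 2 (λ a b → G₄ a b := G₄ b a) refl)
        (solve 2 (λ a b → G₄ a (a :+ b) := G₄ b (a :+ b)) refl)
        (solve 2 (λ a b → G₄ a b := G₄ a (a :+ b) :+ bilinearₚ bs (a :^_) (b :^_)) refl)
        (solve 1 (λ a → G₄ a a := con (+ 1) :* a :^ suc 3) refl)
        (solve 1 (λ a → T₄ (# 0) a := # 0) refl)
        (solve 2 (λ x a → T₄ (# 1 :+ x) a := T₄ x a :+ # 30 :* G₄ (# 1 :+ x) a) refl)
        (solve 1 (λ x → T₄ x (# 1 :+ x) := linearₚ ls ((# 1 :+ x) :^_)) refl)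

    -- `G₆` vanishes on the diagonal, so `γ` is 0, no derivative survives and the relation is purely
    -- algebraic.
    E₈≈E₄² : E₈ ≈ E₄ * E₄
    E₈≈E₄² = cross (*-congˡ {κ (+ 480)} relation)
      (solve 4 (λ s₁ s₃ s₇ t → # 1 :+ # 480 :* s₇ :+ # 480 :* (# 30 :* (# 0 :* t))
        := (# 1 :+ # 240 :* s₃) :* (# 1 :+ # 240 :* s₃) :+
           # 480 :* (# 30 :* (con (ℤ.- + 4) :* (s₃ :* s₃) :+ # 0) :+
             (con (ℤ.- + 1) :* s₃ :+ (# 1 :* s₇ :+ # 0)) :+ # 30 :* (# 0 :* s₁)))
        refl (s 1) (s 3) (s 7) (s′ 0))
      where
      ls = (ℤ.- + 1 , 3) ∷ (+ 1 , 7) ∷ []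
      bs = (ℤ.- + 4 , 3 , 3) ∷ []
      relation = convolution-relation (G₆ (var 0F) (var 1F)) (T₆ (var 0F) (var 1F)) (+ 30) (+ 0) 0 ls bs
        (solve 2 (λ a b → G₆ a b := G₆ b a) refl)
        (solve 2 (λ a b → G₆ a (a :+ b) := G₆ b (a :+ b)) refl)
        (solve 2 (λ a b → G₆ a b := G₆ a (a :+ b) :+ bilinearₚ bs (a :^_) (b :^_)) refl)
        (solve 1 (λ a → G₆ a a := con (+ 0) :* a :^ suc 0) refl)
        (solve 1 (λ a → T₆ (# 0) a := # 0) refl)
        (solve 2 (λ x a → T₆ (# 1 :+ x) a := T₆ x a :+ # 30 :* G₆ (# 1 :+ x) a) refl)
        (solve 1 (λ x → T₆ x (# 1 :+ x) := linearₚ ls ((# 1 :+ x) :^_)) refl)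

    -- The prime 691 enters through the Bernoulli number -691/2730 in the sum of twelfth powers:
    -- with the coefficient -2730 of a^12 in `G₁₂` and K = 2 it gives 1382 = 2 · 691 in `ls`. The
    -- terms in `s 12` cancel.
    E₁₂-derivative : κ (+ 65520) * s′ 11 ≈ E₂ * E₁₂ - κ (+ 691) * (E₆ * E₈)
    E₁₂-derivative = cross (*-congˡ {κ (+ 12)} relation)
      (solve 6 (λ s₁ s₅ s₇ s₁₁ s₁₂ t → # 65520 :* t :+ # 12 :* (# 2 :* (con (ℤ.- + 2730) :* t))
        := (# 1 :- # 24 :* s₁) :* (# 691 :+ # 65520 :* s₁₁) :- # 691 :* ((# 1 :- # 504 :* s₅) :* (# 1 :+ # 480 :* s₇)) :+
           # 12 :* (# 2 :* (# 32760 :* (s₁ :* s₁₁) :+ (# 32760 :* (s₁₁ :* s₁) :+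
             (con (ℤ.- + 3482640) :* (s₅ :* s₇) :+ (con (ℤ.- + 3482640) :* (s₇ :* s₅) :+ # 0)))) :+
             (# 1382 :* s₁ :+ (con (ℤ.- + 29022) :* s₅ :+ (# 27640 :* s₇ :+ (con (ℤ.- + 5460) :* s₁₁ :+ (# 5460 :* s₁₂ :+ # 0))))) :+
             # 2 :* (con (ℤ.- + 2730) :* s₁₂)))
        refl (s 1) (s 5) (s 7) (s 11) (s 12) (s′ 11))
      where
      ls = (+ 1382 , 1) ∷ (ℤ.- + 29022 , 5) ∷ (+ 27640 , 7) ∷ (ℤ.- + 5460 , 11) ∷ (+ 5460 , 12) ∷ []
      bs = (+ 32760 , 1 , 11) ∷ (+ 32760 , 11 , 1) ∷ (ℤ.- + 3482640 , 5 , 7) ∷ (ℤ.- + 3482640 , 7 , 5) ∷ []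
      relation = convolution-relation (G₁₂ (var 0F) (var 1F)) (T₁₂ (var 0F) (var 1F)) (+ 2) (ℤ.- + 2730) 11 ls bs
        (solve 2 (λ a b → G₁₂ a b := G₁₂ b a) refl)
        (solve 2 (λ a b → G₁₂ a (a :+ b) := G₁₂ b (a :+ b)) refl)
        (solve 2 (λ a b → G₁₂ a b := G₁₂ a (a :+ b) :+ bilinearₚ bs (a :^_) (b :^_)) refl)
        (solve 1 (λ a → G₁₂ a a := con (ℤ.- + 2730) :* a :^ suc 11) refl)
        (solve 1 (λ a → T₁₂ (# 0) a := # 0) refl)
        (solve 2 (λ x a → T₁₂ (# 1 :+ x) a := T₁₂ x a :+ # 2 :* G₁₂ (# 1 :+ x) a) refl)
        (solve 1 (λ x → T₁₂ x (# 1 :+ x) := linearₚ ls ((# 1 :+ x) :^_)) refl)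

-- Derivations and the differential equation of the discriminant

module Geometric {c ℓ} (R : CommutativeSemiring c ℓ) where
  open CommutativeSemiring R
  open import Algebra.Solver.Ring.NaturalCoefficients.Default R
  open import Relation.Binary.Reasoning.Setoid setoid

  -- Here x = p/(1 - p) and y = q/(1 - q). The form u + p q · (x y) replaces division by 1 - p q:
  -- `geometric-scale` supplies another solution of the same equation, and `fixpoint-unique`
  -- identifies the two in `w*w`.
  geometric-* : ∀ {p q x y} → x ≈ p * (1# + x) → y ≈ q * (1# + y) →
    x * y ≈ p * q * (x + y + 1#) + p * q * (x * y)
  geometric-* {p} {q} {x} {y} x≈ y≈ = begin
    x * y                         ≈⟨ *-cong x≈ y≈ ⟩
    p * (1# + x) * (q * (1# + y)) ≈⟨ solve 4 (λ p q x y → p :* (con 1 :+ x) :* (q :* (con 1 :+ y)) :=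
                                       p :* q :* (x :+ y :+ con 1) :+ p :* q :* (x :* y)) refl p q x y ⟩
    p * q * (x + y + 1#) + p * q * (x * y) ∎

  geometric-scale : ∀ {p x} t → x ≈ p * (1# + x) → x * t ≈ p * t + p * (x * t)
  geometric-scale {p} {x} t x≈ = begin
    x * t              ≈⟨ *-congʳ x≈ ⟩
    p * (1# + x) * t   ≈⟨ solve 3 (λ p x t → p :* (con 1 :+ x) :* t := p :* t :+ p :* (x :* t)) refl p x t ⟩
    p * t + p * (x * t) ∎

  geometric-square : ∀ {p x} a → x ≈ p * (1# + x) → a * (x + x * x) ≈ a * x + p * (a * (x + x * x))
  geometric-square {p} {x} a x≈ = begin
    a * (x + x * x)               ≈⟨ *-congˡ (+-congˡ (*-congʳ x≈)) ⟩
    a * (x + p * (1# + x) * x)    ≈⟨ solve 3 (λ p x a → a :* (x :+ p :* (con 1 :+ x) :* x) := a :* x :+ p :* (a :* (x :+ x :* x))) refl p x a ⟩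
    a * x + p * (a * (x + x * x)) ∎

module Derivation {c ℓ} (R : CommutativeRing c ℓ) (hom : ℤ-rawRing -Raw-AlmostCommutative⟶ fromCommutativeRing R) where
  open CommutativeRing R
  open _-Raw-AlmostCommutative⟶_ hom renaming (⟦_⟧ to κ)
  open ℤ-Solver R hom
  open RangeSums commutativeSemiring
  open import Algebra.Properties.Semiring.Exp semiring using (_^_; ^-congˡ)
  open import Relation.Binary.Reasoning.Setoid setoid

  module Rules (δ : Carrier → Carrier)
    (δ-cong : ∀ {x y} → x ≈ y → δ x ≈ δ y)
    (δ-+ : ∀ x y → δ (x + y) ≈ δ x + δ y)
    (δ-* : ∀ x y → δ (x * y) ≈ δ x * y + x * δ y)
    (δ-κ : ∀ a → δ (κ a) ≈ κ (+ 0))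
    where

    δ-κ* : ∀ a x → δ (κ a * x) ≈ κ a * δ x
    δ-κ* a x = begin
      δ (κ a * x)               ≈⟨ δ-* (κ a) x ⟩
      δ (κ a) * x + κ a * δ x   ≈⟨ +-congʳ (*-congʳ (δ-κ a)) ⟩
      κ (+ 0) * x + κ a * δ x   ≈⟨ solve 3 (λ x a y → # 0 :* x :+ a :* y := a :* y) refl x (κ a) (δ x) ⟩
      κ a * δ x                 ∎

    δ-1 : δ 1# ≈ 0#
    δ-1 = trans (δ-cong (sym 1-homo)) (trans (δ-κ (+ 1)) 0-homo)

    δ-- : ∀ x y → δ (x - y) ≈ δ x - δ y
    δ-- x y = begin
      δ (x - y)                    ≈⟨ δ-cong (solve 2 (λ x y → x :- y := x :+ con (ℤ.- + 1) :* y) refl x y) ⟩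
      δ (x + κ (ℤ.- + 1) * y)      ≈⟨ trans (δ-+ _ _) (+-congˡ (δ-κ* _ y)) ⟩
      δ x + κ (ℤ.- + 1) * δ y      ≈⟨ solve 2 (λ x y → x :+ con (ℤ.- + 1) :* y := x :- y) refl (δ x) (δ y) ⟩
      δ x - δ y                    ∎

    δ-affine : ∀ a b x → δ (κ a + κ b * x) ≈ κ b * δ x
    δ-affine a b x = begin
      δ (κ a + κ b * x)      ≈⟨ trans (δ-+ _ _) (+-cong (trans (δ-κ a) 0-homo) (δ-κ* b x)) ⟩
      0# + κ b * δ x         ≈⟨ +-identityˡ _ ⟩
      κ b * δ x              ∎

    δ-∑ : ∀ {n} (f : Fin n → Carrier) → δ (∑[ i < n ] f i) ≈ ∑[ i < n ] δ (f i)
    δ-∑ {zero}  f = trans (δ-cong (sym 0-homo)) (trans (δ-κ (+ 0)) 0-homo)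
    δ-∑ {suc n} f = trans (δ-+ _ _) (+-congˡ (δ-∑ (λ i → f (suc i))))

    -- Leibniz gives a p (1 + x) + p δ x, and p (1 + x) folds back to x. `geometric-square` solves
    -- the same equation, whence `D-w`.
    geometric-derivative : ∀ {p x a} → δ p ≈ a * p → x ≈ p * (1# + x) → δ x ≈ a * x + p * δ x
    geometric-derivative {p} {x} {a} δp x≈ = begin
      δ x                                ≈⟨ δ-cong x≈ ⟩
      δ (p * (1# + x))                   ≈⟨ δ-* p (1# + x) ⟩
      δ p * (1# + x) + p * δ (1# + x)    ≈⟨ +-cong (*-congʳ δp) (*-congˡ (trans (δ-+ 1# x) (trans (+-congʳ δ-1) (+-identityˡ (δ x))))) ⟩
      a * p * (1# + x) + p * δ x         ≈⟨ +-congʳ (trans (*-assoc a p (1# + x)) (*-congˡ (sym x≈))) ⟩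
      a * x + p * δ x                    ∎

    -- `δ f ≈ u * f` is the division-free form of δ f / f = u.
    logarithmic-* : ∀ {f g u v} → δ f ≈ u * f → δ g ≈ v * g → δ (f * g) ≈ (u + v) * (f * g)
    logarithmic-* {f} {g} {u} {v} δf δg = begin
      δ (f * g)              ≈⟨ trans (δ-* f g) (+-cong (*-congʳ δf) (*-congˡ δg)) ⟩
      u * f * g + f * (v * g) ≈⟨ solve 4 (λ f g u v → u :* f :* g :+ f :* (v :* g) := (u :+ v) :* (f :* g)) refl f g u v ⟩
      (u + v) * (f * g)      ∎

    logarithmic-^ : ∀ {f u} → δ f ≈ u * f → ∀ k → δ (f ^ k) ≈ κ (+ k) * u * f ^ k
    logarithmic-^ {f} {u} δf zero    = begin
      δ 1#              ≈⟨ δ-1 ⟩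
      0#                ≈⟨ 0-homo ⟨
      κ (+ 0)           ≈⟨ solve 2 (λ u o → # 0 := # 0 :* u :* o) refl u 1# ⟩
      κ (+ 0) * u * 1#  ∎
    logarithmic-^ {f} {u} δf (suc k) = begin
      δ (f * f ^ k)                          ≈⟨ logarithmic-* δf (logarithmic-^ δf k) ⟩
      (u + κ (+ k) * u) * (f * f ^ k)        ≈⟨ *-congʳ (solve 2 (λ u k → u :+ k :* u := (# 1 :+ k) :* u) refl u (κ (+ k))) ⟩
      (κ (+ 1) + κ (+ k)) * u * (f * f ^ k)  ≈⟨ *-congʳ (*-congʳ (+-homo (+ 1) (+ k))) ⟨
      κ (+ suc k) * u * (f * f ^ k)          ∎

    -- As x = p/(1 - p), the derivative - a p is - a x (1 - p). Thus a factor 1 - q^a of the product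
    -- contributes - a z a, and all factors together produce σ₁.
    logarithmic-geometric : ∀ {p x a} → δ p ≈ a * p → x ≈ p * (1# + x) → δ (1# - p) ≈ - (a * x) * (1# - p)
    logarithmic-geometric {p} {x} {a} δp x≈ = begin
      δ (1# - p)                ≈⟨ trans (δ-- 1# p) (+-cong δ-1 (-‿cong δp)) ⟩
      0# - a * p                ≈⟨ trans (+-identityˡ _) (-‿cong (*-congˡ p≈)) ⟩
      - (a * (x * (1# - p)))    ≈⟨ solve 3 (λ a x t → :- (a :* (x :* t)) := :- (a :* x) :* t) refl a x (1# - p) ⟩
      - (a * x) * (1# - p)      ∎
      where
      p≈ : p ≈ x * (1# - p)
      p≈ = begin
        p                       ≈⟨ solve 2 (λ p x → p := p :* (# 1 :+ x) :- x :* p) refl p x ⟩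
        p * (κ (+ 1) + x) - x * p ≈⟨ +-congʳ (trans (*-congˡ (+-congʳ 1-homo)) (sym x≈)) ⟩
        x - x * p               ≈⟨ +-congʳ (*-identityʳ x) ⟨
        x * 1# - x * p          ≈⟨ solve 3 (λ x o p → x :* o :- x :* p := x :* (o :- p)) refl x 1# p ⟩
        x * (1# - p)            ∎

    module Discrepancy {E₂ E₄ E₆ E₈ E₁₂ Δ : Carrier}
      (δE₄  : κ (+ 3) * δ E₄ ≈ E₂ * E₄ - E₆)
      (E₈≈E₄² : E₈ ≈ E₄ * E₄)
      (δE₁₂ : δ E₁₂ ≈ E₂ * E₁₂ - κ (+ 691) * (E₆ * E₈))
      (δΔ   : δ Δ ≈ E₂ * Δ)
      where

      E₄δE₈ : E₄ * δ E₈ ≈ κ (+ 2) * (δ E₄ * E₈)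
      E₄δE₈ = begin
        E₄ * δ E₈                        ≈⟨ *-congˡ (trans (δ-cong E₈≈E₄²) (δ-* E₄ E₄)) ⟩
        E₄ * (δ E₄ * E₄ + E₄ * δ E₄)     ≈⟨ solve 2 (λ e d → e :* (d :* e :+ e :* d) := # 2 :* (d :* (e :* e))) refl E₄ (δ E₄) ⟩
        κ (+ 2) * (δ E₄ * (E₄ * E₄))     ≈⟨ *-congˡ (*-congˡ E₈≈E₄²) ⟨
        κ (+ 2) * (δ E₄ * E₈)            ∎

      δ[E₄E₈] : δ (E₄ * E₈) ≈ κ (+ 3) * (δ E₄ * E₈)
      δ[E₄E₈] = begin
        δ (E₄ * E₈)                          ≈⟨ trans (δ-* E₄ E₈) (+-congˡ E₄δE₈) ⟩
        δ E₄ * E₈ + κ (+ 2) * (δ E₄ * E₈)    ≈⟨ solve 1 (λ x → x :+ # 2 :* x := # 3 :* x) refl (δ E₄ * E₈) ⟩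
        κ (+ 3) * (δ E₄ * E₈)                ∎

      discrepancy : Carrier
      discrepancy = κ (+ 691) * (E₄ * E₈) - E₁₂ - κ (+ 432000) * Δ

      δ-discrepancy : δ discrepancy ≈ κ (+ 2073) * (δ E₄ * E₈) - δ E₁₂ - κ (+ 432000) * δ Δ
      δ-discrepancy = begin
        δ discrepancy
          ≈⟨ trans (δ-- _ _) (+-cong (trans (δ-- _ _) (+-congʳ (trans (δ-κ* _ _) (*-congˡ δ[E₄E₈])))) (-‿cong (δ-κ* _ _))) ⟩
        κ (+ 691) * (κ (+ 3) * (δ E₄ * E₈)) - δ E₁₂ - κ (+ 432000) * δ Δ
          ≈⟨ +-congʳ (+-congʳ (solve 1 (λ x → # 691 :* (# 3 :* x) := # 2073 :* x) refl (δ E₄ * E₈))) ⟩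
        κ (+ 2073) * (δ E₄ * E₈) - δ E₁₂ - κ (+ 432000) * δ Δ ∎

      -- The terms in E₆ E₈ cancel. `Δ` solves the homogeneous equation, so any multiple of it could
      -- be subtracted here; the coefficient at q fixes 432000.
      discrepancy-ode : δ discrepancy ≈ E₂ * discrepancy
      discrepancy-ode = begin
        δ discrepancy
          ≈⟨ δ-discrepancy ⟩
        κ (+ 2073) * (δ E₄ * E₈) - δ E₁₂ - κ (+ 432000) * δ Δ
          -- 2073 splits as 691 · 3 because `δE₄` speaks of 3 δ E₄.
          ≈⟨ +-congʳ (+-congʳ (solve 2 (λ x y → # 2073 :* (x :* y) := # 691 :* (# 3 :* x :* y)) refl (δ E₄) E₈)) ⟩
        κ (+ 691) * (κ (+ 3) * δ E₄ * E₈) - δ E₁₂ - κ (+ 432000) * δ Δ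
          ≈⟨ +-cong (+-cong (*-congˡ (*-congʳ δE₄)) (-‿cong δE₁₂)) (-‿cong (*-congˡ δΔ)) ⟩
        κ (+ 691) * ((E₂ * E₄ - E₆) * E₈) - (E₂ * E₁₂ - κ (+ 691) * (E₆ * E₈)) - κ (+ 432000) * (E₂ * Δ)
          ≈⟨ solve 6 (λ e₂ e₄ e₆ e₈ e₁₂ d →
               # 691 :* ((e₂ :* e₄ :- e₆) :* e₈) :- (e₂ :* e₁₂ :- # 691 :* (e₆ :* e₈)) :- # 432000 :* (e₂ :* d) :=
               e₂ :* (# 691 :* (e₄ :* e₈) :- e₁₂ :- # 432000 :* d)) refl E₂ E₄ E₆ E₈ E₁₂ Δ ⟩
        E₂ * discrepancy ∎

      module _ (discrepancy≈0 : discrepancy ≈ κ (+ 0)) where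

        E₈δE₄ : κ (+ 2073) * (δ E₄ * E₈) ≈ δ E₁₂ + κ (+ 432000) * δ Δ
        E₈δE₄ = begin
          κ (+ 2073) * (δ E₄ * E₈)
            ≈⟨ solve 3 (λ x y z → x := (x :- y :- z) :+ (y :+ z)) refl _ (δ E₁₂) (κ (+ 432000) * δ Δ) ⟩
          (κ (+ 2073) * (δ E₄ * E₈) - δ E₁₂ - κ (+ 432000) * δ Δ) + (δ E₁₂ + κ (+ 432000) * δ Δ)
            ≈⟨ +-congʳ (trans (sym δ-discrepancy) (trans (δ-cong discrepancy≈0) (trans (δ-κ (+ 0)) 0-homo))) ⟩
          0# + (δ E₁₂ + κ (+ 432000) * δ Δ)
            ≈⟨ +-identityˡ _ ⟩
          δ E₁₂ + κ (+ 432000) * δ Δ ∎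

        E₄δE₈≈ : κ (+ 2073) * (E₄ * δ E₈) ≈ κ (+ 2) * (δ E₁₂ + κ (+ 432000) * δ Δ)
        E₄δE₈≈ = begin
          κ (+ 2073) * (E₄ * δ E₈)               ≈⟨ *-congˡ E₄δE₈ ⟩
          κ (+ 2073) * (κ (+ 2) * (δ E₄ * E₈))   ≈⟨ solve 1 (λ x → # 2073 :* (# 2 :* x) := # 2 :* (# 2073 :* x)) refl _ ⟩
          κ (+ 2) * (κ (+ 2073) * (δ E₄ * E₈))   ≈⟨ *-congˡ E₈δE₄ ⟩
          κ (+ 2) * (δ E₁₂ + κ (+ 432000) * δ Δ) ∎

        module _ {s₃ s₇ d₃ d₇ d₁₁ : Carrier}
          (E₄≈   : E₄ ≈ κ (+ 1) + κ (+ 240) * s₃)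
          (E₈≈   : E₈ ≈ κ (+ 1) + κ (+ 480) * s₇)
          (δE₄≈  : δ E₄ ≈ κ (+ 240) * d₃)
          (δE₈≈  : δ E₈ ≈ κ (+ 480) * d₇)
          (δE₁₂≈ : δ E₁₂ ≈ κ (+ 65520) * d₁₁)
          where

          -- The constants share a factor: 2073 · 240 = 720 · 691, 65520 = 720 · 91 and 432000 = 720
          -- · 600. It stays on both sides, since a general ring need not allow its cancellation.
          series-identity₃ : κ (+ 720) * (κ (+ 691) * (d₃ + κ (+ 480) * (d₃ * s₇))) ≈
                             κ (+ 720) * (κ (+ 91) * d₁₁ + κ (+ 600) * δ Δ)
          series-identity₃ = begin
            κ (+ 720) * (κ (+ 691) * (d₃ + κ (+ 480) * (d₃ * s₇)))
              ≈⟨ solve 2 (λ d₃ s₇ → # 720 :* (# 691 :* (d₃ :+ # 480 :* (d₃ :* s₇))) :=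
                   # 2073 :* (# 240 :* d₃ :* (# 1 :+ # 480 :* s₇))) refl d₃ s₇ ⟩
            κ (+ 2073) * (κ (+ 240) * d₃ * (κ (+ 1) + κ (+ 480) * s₇))
              ≈⟨ *-congˡ (*-cong δE₄≈ E₈≈) ⟨
            κ (+ 2073) * (δ E₄ * E₈)
              ≈⟨ trans E₈δE₄ (+-congʳ δE₁₂≈) ⟩
            κ (+ 65520) * d₁₁ + κ (+ 432000) * δ Δ
              ≈⟨ solve 2 (λ d₁₁ d → # 65520 :* d₁₁ :+ # 432000 :* d := # 720 :* (# 91 :* d₁₁ :+ # 600 :* d)) refl d₁₁ (δ Δ) ⟩
            κ (+ 720) * (κ (+ 91) * d₁₁ + κ (+ 600) * δ Δ) ∎

          series-identity₇ : κ (+ 1440) * (κ (+ 691) * (d₇ + κ (+ 240) * (s₃ * d₇))) ≈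
                             κ (+ 1440) * (κ (+ 91) * d₁₁ + κ (+ 600) * δ Δ)
          series-identity₇ = begin
            κ (+ 1440) * (κ (+ 691) * (d₇ + κ (+ 240) * (s₃ * d₇)))
              ≈⟨ solve 2 (λ d₇ s₃ → # 1440 :* (# 691 :* (d₇ :+ # 240 :* (s₃ :* d₇))) :=
                   # 2073 :* ((# 1 :+ # 240 :* s₃) :* (# 480 :* d₇))) refl d₇ s₃ ⟩
            κ (+ 2073) * ((κ (+ 1) + κ (+ 240) * s₃) * (κ (+ 480) * d₇))
              ≈⟨ *-congˡ (*-cong E₄≈ δE₈≈) ⟨
            κ (+ 2073) * (E₄ * δ E₈)
              ≈⟨ trans E₄δE₈≈ (*-congˡ (+-congʳ δE₁₂≈)) ⟩
            κ (+ 2) * (κ (+ 65520) * d₁₁ + κ (+ 432000) * δ Δ)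
              ≈⟨ solve 2 (λ d₁₁ d → # 2 :* (# 65520 :* d₁₁ :+ # 432000 :* d) := # 1440 :* (# 91 :* d₁₁ :+ # 600 :* d)) refl d₁₁ (δ Δ) ⟩
            κ (+ 1440) * (κ (+ 91) * d₁₁ + κ (+ 600) * δ Δ) ∎

-- Clearing denominators

module ClearDenominators {c ℓ} (R : CommutativeRing c ℓ) (hom : ℤ-rawRing -Raw-AlmostCommutative⟶ fromCommutativeRing R) where
  open CommutativeRing R
  open _-Raw-AlmostCommutative⟶_ hom renaming (⟦_⟧ to κ)
  open ℤ-Solver R hom
  open import Relation.Binary.Reasoning.Setoid setoid

  -- The fractions `e`, `f`, `g` are given by their products with the denominators and so remain
  -- solver variables. The factor 120 = 600/5 lifts the denominator 5 n of `g` to 600 n.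
  clear : ∀ {a b k c} e f g n t x y z →
    e * κ (+ 600) ≈ κ a → f * κ (+ 600) ≈ κ b → g * (κ (+ 5) * n) ≈ κ k → κ (+ 120) * κ k ≈ κ b * κ c →
    κ b * (n * y + κ c * z) ≈ κ a * (n * x) + κ (+ 600) * (n * t) →
    κ (+ 600) * n * t ≈ κ (+ 600) * n * (- e * x + f * y + g * z)
  clear {a} {b} {k} {c} e f g n t x y z e≈ f≈ g≈ k≈ eq = begin
    κ (+ 600) * n * t
      ≈⟨ solve 4 (λ a n t x → # 600 :* n :* t := :- a :* (n :* x) :+ (a :* (n :* x) :+ # 600 :* (n :* t))) refl (κ a) n t x ⟩
    - κ a * (n * x) + (κ a * (n * x) + κ (+ 600) * (n * t))
      ≈⟨ +-congˡ eq ⟨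
    - κ a * (n * x) + κ b * (n * y + κ c * z)
      ≈⟨ solve 7 (λ a b c n x y z → :- a :* (n :* x) :+ b :* (n :* y :+ c :* z) := :- a :* (n :* x) :+ b :* (n :* y) :+ b :* c :* z) refl
           (κ a) (κ b) (κ c) n x y z ⟩
    - κ a * (n * x) + κ b * (n * y) + κ b * κ c * z
      ≈⟨ +-cong (+-cong (*-congʳ (-‿cong e≈)) (*-congʳ f≈)) (*-congʳ (trans (*-congˡ g≈) k≈)) ⟨
    - (e * κ (+ 600)) * (n * x) + f * κ (+ 600) * (n * y) + κ (+ 120) * (g * (κ (+ 5) * n)) * z
      ≈⟨ solve 7 (λ e f g n x y z →
           :- (e :* # 600) :* (n :* x) :+ f :* # 600 :* (n :* y) :+ # 120 :* (g :* (# 5 :* n)) :* z :=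
           # 600 :* n :* (:- e :* x :+ f :* y :+ g :* z)) refl e f g n x y z ⟩
    κ (+ 600) * n * (- e * x + f * y + g * z) ∎

-- Power series

open ≡ using (refl; cong; cong₂; module ≡-Reasoning)

module ℤ∑ = RangeSums ℤ.+-*-commutativeSemiring
open ℤ∑ using (sum-syntax; sum⁺-syntax; sum-cong-≗)
open import Algebra.Properties.AbelianGroup ℤ.+-0-abelianGroup using () renaming (∙-cancelˡ to ℤ-+-cancelˡ)

infixl 6 _⊞_
infixr 8 _•_
infix  8 ⊟_

_⊞_ : PowerSeries → PowerSeries → PowerSeries
(f ⊞ g) n = f n ℤ.+ g n

⊟_ : PowerSeries → PowerSeries
(⊟ f) n = ℤ.- f n

_•_ : ℤ → PowerSeries → PowerSeries
(c • f) n = c ℤ.* f n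

const : ℤ → PowerSeries
const c zero    = c
const c (suc _) = 0ℤ

summand : PowerSeries → PowerSeries → ∀ n → Fin (suc n) → ℤ
summand f g n i = f (toℕ i) ℤ.* g (n ∸ toℕ i)

D : PowerSeries → PowerSeries
D f n = + n ℤ.* f n

⊛-cong : ∀ n {f f′ g g′} → (∀ i → i ≤ n → f i ≡ f′ i) → (∀ i → i ≤ n → g i ≡ g′ i) → (f ⊛ g) n ≡ (f′ ⊛ g′) n
⊛-cong n f≡ g≡ = sum-cong-≗ {suc n} λ i → cong₂ ℤ._*_ (f≡ (toℕ i) (ℕ.≤-pred (toℕ<n i))) (g≡ (n ∸ toℕ i) (ℕ.m∸n≤m n (toℕ i)))

⊛-cong-≗ : ∀ n {f f′ g g′} → (∀ i → f i ≡ f′ i) → (∀ i → g i ≡ g′ i) → (f ⊛ g) n ≡ (f′ ⊛ g′) n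
⊛-cong-≗ n f≡ g≡ = ⊛-cong n (λ i _ → f≡ i) (λ i _ → g≡ i)

⊛-distribˡ : ∀ f g h n → (f ⊛ (g ⊞ h)) n ≡ (f ⊛ g) n ℤ.+ (f ⊛ h) n
⊛-distribˡ f g h n = ≡.trans
  (sum-cong-≗ {suc n} λ i → ℤ.*-distribˡ-+ (f (toℕ i)) (g (n ∸ toℕ i)) (h (n ∸ toℕ i)))
  (ℤ∑.∑-distrib-+ (summand f g n) (summand f h n))

⊛-distribʳ : ∀ f g h n → ((g ⊞ h) ⊛ f) n ≡ (g ⊛ f) n ℤ.+ (h ⊛ f) n
⊛-distribʳ f g h n = ≡.trans
  (sum-cong-≗ {suc n} λ i → ℤ.*-distribʳ-+ (f (n ∸ toℕ i)) (g (toℕ i)) (h (toℕ i)))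
  (ℤ∑.∑-distrib-+ (summand g f n) (summand h f n))

•-⊛ : ∀ c f g n → ((c • f) ⊛ g) n ≡ c ℤ.* (f ⊛ g) n
•-⊛ c f g n = ≡.trans
  (sum-cong-≗ {suc n} λ i → ℤ.*-assoc c (f (toℕ i)) (g (n ∸ toℕ i)))
  (≡.sym (ℤ∑.*-distribˡ-sum c (summand f g n)))

-- Convolution unfolds by definition at its first summand, which shifts `f`. Splitting off the last
-- one shifts `g` instead, and `⊛-comm` plays the two against each other.
⊛-last : ∀ f g n → (f ⊛ g) (suc n) ≡ (f ⊛ (g ∘ suc)) n ℤ.+ f (suc n) ℤ.* g 0
⊛-last f g zero    = lemma (f 0 ℤ.* g 1) (f 1 ℤ.* g 0)
  where
  lemma : ∀ x y → x ℤ.+ (y ℤ.+ 0ℤ) ≡ x ℤ.+ 0ℤ ℤ.+ y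
  lemma = ℤ-solve-∀
⊛-last f g (suc n) = ≡.trans (cong (λ x → f 0 ℤ.* g (suc (suc n)) ℤ.+ x) (⊛-last (f ∘ suc) g n))
  (≡.sym (ℤ.+-assoc (f 0 ℤ.* g (suc (suc n))) _ _))

⊛-comm : ∀ f g n → (f ⊛ g) n ≡ (g ⊛ f) n
⊛-comm f g zero    = cong (ℤ._+ 0ℤ) (ℤ.*-comm (f 0) (g 0))
⊛-comm f g (suc n) = begin
  f 0 ℤ.* g (suc n) ℤ.+ ((f ∘ suc) ⊛ g) n   ≡⟨ cong₂ ℤ._+_ (ℤ.*-comm (f 0) (g (suc n))) (⊛-comm (f ∘ suc) g n) ⟩
  g (suc n) ℤ.* f 0 ℤ.+ (g ⊛ (f ∘ suc)) n   ≡⟨ ℤ.+-comm (g (suc n) ℤ.* f 0) _ ⟩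
  (g ⊛ (f ∘ suc)) n ℤ.+ g (suc n) ℤ.* f 0   ≡⟨ ⊛-last g f n ⟨
  (g ⊛ f) (suc n)                           ∎
  where open ≡-Reasoning

⊛-assoc : ∀ f g h n → ((f ⊛ g) ⊛ h) n ≡ (f ⊛ (g ⊛ h)) n
⊛-assoc f g h zero    = lemma (f 0) (g 0) (h 0)
  where
  lemma : ∀ x y z → (x ℤ.* y ℤ.+ 0ℤ) ℤ.* z ℤ.+ 0ℤ ≡ x ℤ.* (y ℤ.* z ℤ.+ 0ℤ) ℤ.+ 0ℤ
  lemma = ℤ-solve-∀
⊛-assoc f g h (suc n) = begin
  -- By definition, shifting f ⊛ g gives f 0 times the shifted g plus the shifted f convolved with
  -- g.
  (f ⊛ g) 0 ℤ.* h (suc n) ℤ.+ ((f 0 • (g ∘ suc) ⊞ (f ∘ suc) ⊛ g) ⊛ h) n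
    ≡⟨ cong (λ x → (f ⊛ g) 0 ℤ.* h (suc n) ℤ.+ x) (≡.trans (⊛-distribʳ h (f 0 • (g ∘ suc)) ((f ∘ suc) ⊛ g) n)
         (cong₂ ℤ._+_ (•-⊛ (f 0) (g ∘ suc) h n) (⊛-assoc (f ∘ suc) g h n))) ⟩
  (f 0 ℤ.* g 0 ℤ.+ 0ℤ) ℤ.* h (suc n) ℤ.+ (f 0 ℤ.* ((g ∘ suc) ⊛ h) n ℤ.+ ((f ∘ suc) ⊛ (g ⊛ h)) n)
    ≡⟨ lemma (f 0) (g 0) (h (suc n)) (((g ∘ suc) ⊛ h) n) _ ⟩
  f 0 ℤ.* (g 0 ℤ.* h (suc n) ℤ.+ ((g ∘ suc) ⊛ h) n) ℤ.+ ((f ∘ suc) ⊛ (g ⊛ h)) n ∎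
  where
  open ≡-Reasoning
  lemma : ∀ x y z u v → (x ℤ.* y ℤ.+ 0ℤ) ℤ.* z ℤ.+ (x ℤ.* u ℤ.+ v) ≡ x ℤ.* (y ℤ.* z ℤ.+ u) ℤ.+ v
  lemma = ℤ-solve-∀

const-⊛ : ∀ c f n → (const c ⊛ f) n ≡ c ℤ.* f n
const-⊛ c f zero    = ℤ.+-identityʳ _
const-⊛ c f (suc n) = ≡.trans
  (cong (λ x → c ℤ.* f (suc n) ℤ.+ x) (ℤ∑.∑-zero {suc n} {λ i → 0ℤ ℤ.* f (n ∸ toℕ i)} λ i → ℤ.*-zeroˡ (f (n ∸ toℕ i))))
  (ℤ.+-identityʳ _)

const-0 : ∀ n → const 0ℤ n ≡ 0ℤ
const-0 zero    = refl
const-0 (suc n) = refl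

q^0≗const : ∀ n → (q^ 0) n ≡ const 1ℤ n
q^0≗const zero    = refl
q^0≗const (suc n) = refl

⊛-identityˡ : ∀ f n → (q^ 0 ⊛ f) n ≡ f n
⊛-identityˡ f n = ≡.trans (⊛-cong-≗ n {g = f} q^0≗const λ _ → refl)
  (≡.trans (const-⊛ 1ℤ f n) (ℤ.*-identityˡ (f n)))

D-⊛ : ∀ f g n → D (f ⊛ g) n ≡ (D f ⊛ g) n ℤ.+ (f ⊛ D g) n
D-⊛ f g n = begin
  + n ℤ.* (f ⊛ g) n
    ≡⟨ ℤ∑.*-distribˡ-sum (+ n) (summand f g n) ⟩
  ∑[ i ≤ n ] (+ n ℤ.* (f (toℕ i) ℤ.* g (n ∸ toℕ i)))
    -- n is split as i + (n - i), one part for each factor.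
    ≡⟨ sum-cong-≗ {suc n} (λ i → ≡.trans (cong (λ m → + m ℤ.* (f (toℕ i) ℤ.* g (n ∸ toℕ i)))
         (≡.sym (ℕ.m+[n∸m]≡n {toℕ i} {n} (ℕ.≤-pred (toℕ<n i)))))
         (lemma (+ toℕ i) (+ (n ∸ toℕ i)) (f (toℕ i)) (g (n ∸ toℕ i)))) ⟩
  ∑[ i ≤ n ] (+ toℕ i ℤ.* f (toℕ i) ℤ.* g (n ∸ toℕ i) ℤ.+ f (toℕ i) ℤ.* (+ (n ∸ toℕ i) ℤ.* g (n ∸ toℕ i)))
    ≡⟨ ℤ∑.∑-distrib-+ (summand (D f) g n) (summand f (D g) n) ⟩
  (D f ⊛ g) n ℤ.+ (f ⊛ D g) n ∎
  where
  open ≡-Reasoning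
  lemma : ∀ a b x y → (a ℤ.+ b) ℤ.* (x ℤ.* y) ≡ a ℤ.* x ℤ.* y ℤ.+ x ℤ.* (b ℤ.* y)
  lemma = ℤ-solve-∀

-- Opaque, since comparing nested products by unfolding the convolution takes
-- exponential time.
infixl 7 _⊗_

opaque

  _⊗_ : PowerSeries → PowerSeries → PowerSeries
  _⊗_ = _⊛_

  ⊛≡⊗ : ∀ f g → f ⊛ g ≡ f ⊗ g
  ⊛≡⊗ f g = refl

  ⊗-cong : ∀ n {f f′ g g′} → (∀ i → i ≤ n → f i ≡ f′ i) → (∀ i → i ≤ n → g i ≡ g′ i) → (f ⊗ g) n ≡ (f′ ⊗ g′) n
  ⊗-cong = ⊛-cong

  ⊗-assoc : ∀ f g h n → ((f ⊗ g) ⊗ h) n ≡ (f ⊗ (g ⊗ h)) n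
  ⊗-assoc = ⊛-assoc

  ⊗-comm : ∀ f g n → (f ⊗ g) n ≡ (g ⊗ f) n
  ⊗-comm = ⊛-comm

  ⊗-identityˡ : ∀ f n → (q^ 0 ⊗ f) n ≡ f n
  ⊗-identityˡ = ⊛-identityˡ

  ⊗-distribˡ : ∀ f g h n → (f ⊗ (g ⊞ h)) n ≡ (f ⊗ g) n ℤ.+ (f ⊗ h) n
  ⊗-distribˡ = ⊛-distribˡ

  ⊗-distribʳ : ∀ f g h n → ((g ⊞ h) ⊗ f) n ≡ (g ⊗ f) n ℤ.+ (h ⊗ f) n
  ⊗-distribʳ = ⊛-distribʳ

  const-⊗ : ∀ c f n → (const c ⊗ f) n ≡ c ℤ.* f n
  const-⊗ = const-⊛

  ⊗-suc : ∀ f g n → (f ⊗ g) (suc n) ≡ f 0 ℤ.* g (suc n) ℤ.+ ((f ∘ suc) ⊗ g) n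
  ⊗-suc f g n = refl

  ⊗-zero : ∀ f {g} n → (∀ i → i ≤ n → g i ≡ 0ℤ) → (f ⊗ g) n ≡ 0ℤ
  ⊗-zero f {g} n g≡0 = ℤ∑.∑-zero {suc n} {summand f g n} λ i →
    ≡.trans (cong (f (toℕ i) ℤ.*_) (g≡0 (n ∸ toℕ i) (ℕ.m∸n≤m n (toℕ i)))) (ℤ.*-zeroʳ (f (toℕ i)))

  D-⊗ : ∀ f g n → D (f ⊗ g) n ≡ (D f ⊗ g) n ℤ.+ (f ⊗ D g) n
  D-⊗ = D-⊛

-- Equality modulo q^N, for which the sums over all z a become finite.
module Truncated (N : ℕ) where

  infix 4 _≈_

  record _≈_ (f g : PowerSeries) : Set where
    constructor coefficients
    field
      coefficient : ∀ {n} → n < N → f n ≡ g n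
  open _≈_ public

  pointwise : ∀ {f g} → (∀ n → f n ≡ g n) → f ≈ g
  pointwise f≡g = coefficients λ {n} _ → f≡g n

  commutativeRing : CommutativeRing _ _
  commutativeRing = record
    { Carrier = PowerSeries
    ; _≈_ = _≈_
    ; _+_ = _⊞_
    ; _*_ = _⊗_
    ; -_  = ⊟_
    ; 0#  = const 0ℤ
    -- With `q^ 0` as the unit, `f ↑ zero` and the empty product are literally `1#`.
    ; 1#  = q^ 0
    ; isCommutativeRing = record
      { isRing = record
        { +-isAbelianGroup = record
          { isGroup = record
            { isMonoid = record
              { isSemigroup = record
                { isMagma = record
                  { isEquivalence = record
                    { refl  = pointwise λ _ → refl
                    ; sym   = λ p → coefficients λ n<N → ≡.sym (coefficient p n<N)
                    ; trans = λ p q → coefficients λ n<N → ≡.trans (coefficient p n<N) (coefficient q n<N)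
                    }
                  ; ∙-cong = λ p q → coefficients λ n<N → cong₂ ℤ._+_ (coefficient p n<N) (coefficient q n<N)
                  }
                ; assoc = λ f g h → pointwise λ n → ℤ.+-assoc (f n) (g n) (h n)
                }
              ; identity = (λ f → pointwise λ n → ≡.trans (cong (ℤ._+ f n) (const-0 n)) (ℤ.+-identityˡ (f n)))
                         , (λ f → pointwise λ n → ≡.trans (cong (λ x → f n ℤ.+ x) (const-0 n)) (ℤ.+-identityʳ (f n)))
              }
            ; inverse = (λ f → pointwise λ n → ≡.trans (ℤ.+-inverseˡ (f n)) (≡.sym (const-0 n)))
                      , (λ f → pointwise λ n → ≡.trans (ℤ.+-inverseʳ (f n)) (≡.sym (const-0 n)))
            ; ⁻¹-cong = λ p → coefficients λ n<N → cong ℤ.-_ (coefficient p n<N)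
            }
          ; comm = λ f g → pointwise λ n → ℤ.+-comm (f n) (g n)
          }
        ; *-cong = λ p q → coefficients λ {n} n<N → ⊗-cong n
            (λ i i≤n → coefficient p (ℕ.≤-<-trans i≤n n<N)) (λ i i≤n → coefficient q (ℕ.≤-<-trans i≤n n<N))
        ; *-assoc = λ f g h → pointwise (⊗-assoc f g h)
        ; *-identity = (λ f → pointwise (⊗-identityˡ f))
                     , (λ f → pointwise λ n → ≡.trans (⊗-comm f (q^ 0) n) (⊗-identityˡ f n))
        ; distrib = (λ f g h → pointwise (⊗-distribˡ f g h)) , (λ f g h → pointwise (⊗-distribʳ f g h))
        }
      ; *-comm = λ f g → pointwise (⊗-comm f g)
      }
    }

  const-+ : ∀ a b → const (a ℤ.+ b) ≈ const a ⊞ const b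
  const-+ a b = pointwise λ where
    zero    → refl
    (suc n) → refl

  const-* : ∀ a b → const (a ℤ.* b) ≈ const a ⊗ const b
  const-* a b = pointwise λ n → ≡.sym (≡.trans (const-⊗ a (const b) n) (lemma n))
    where
    lemma : ∀ n → a ℤ.* const b n ≡ const (a ℤ.* b) n
    lemma zero    = refl
    lemma (suc n) = ℤ.*-zeroʳ a

  const-hom : ℤ-rawRing -Raw-AlmostCommutative⟶ fromCommutativeRing commutativeRing
  const-hom = record
    { ⟦_⟧    = const
    ; +-homo = const-+
    ; *-homo = const-*
    ; -‿homo = λ c → pointwise λ where
        zero    → refl
        (suc n) → refl
    ; 0-homo = pointwise λ _ → refl
    ; 1-homo = pointwise λ n → ≡.sym (q^0≗const n)
    }

  D-cong : ∀ {f g} → f ≈ g → D f ≈ D g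
  D-cong p = coefficients λ {n} n<N → cong (+ n ℤ.*_) (coefficient p n<N)

  D-leibniz : ∀ f g → D (f ⊗ g) ≈ D f ⊗ g ⊞ f ⊗ D g
  D-leibniz f g = pointwise (D-⊗ f g)

  D-+ : ∀ f g → D (f ⊞ g) ≈ D f ⊞ D g
  D-+ f g = pointwise λ n → ℤ.*-distribˡ-+ (+ n) (f n) (g n)

  D-const : ∀ c → D (const c) ≈ const 0ℤ
  D-const c = pointwise λ where
    zero    → refl
    (suc n) → ℤ.*-zeroʳ (+ suc n)

-- Eisenstein series and the tau function

σ-series : ℕ → PowerSeries
σ-series k n = + σ k n

-- The series z a = q^a + q^(2a) + ... of the overview. The constant term is set apart because every
-- a divides 0.
lambert : ℕ → PowerSeries
lambert a zero    = 0ℤ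
lambert a (suc n) = if does (a ∣? suc n) then 1ℤ else 0ℤ

lambert-< : ∀ a {n} → n < a → lambert a n ≡ 0ℤ
lambert-< a {zero}  n<a = refl
lambert-< a {suc n} n<a = cong (if_then 1ℤ else 0ℤ) (dec-false (a ∣? suc n) (>⇒∤ n<a))

opaque
  unfolding _⊗_

  q^-⊗-< : ∀ a f {n} → n < a → (q^ a ⊗ f) n ≡ 0ℤ
  q^-⊗-< (suc a) f {zero}  n<a = ≡.trans (ℤ.+-identityʳ _) (ℤ.*-zeroˡ (f 0))
  q^-⊗-< (suc a) f {suc n} n<a = ≡.trans (cong (ℤ._+ (q^ a ⊗ f) n) (ℤ.*-zeroˡ (f (suc n))))
    (≡.trans (ℤ.+-identityˡ _) (q^-⊗-< a f (s<s⁻¹ n<a)))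

  q^-⊗-+ : ∀ a f n → (q^ a ⊗ f) (a ℕ.+ n) ≡ f n
  q^-⊗-+ zero    f n = ⊗-identityˡ f n
  q^-⊗-+ (suc a) f n = ≡.trans (cong (ℤ._+ (q^ a ⊗ f) (a ℕ.+ n)) (ℤ.*-zeroˡ (f (suc a ℕ.+ n))))
    (≡.trans (ℤ.+-identityˡ _) (q^-⊗-+ a f n))

q^-split : ∀ {p} (P : ℕ → Set p) a → (∀ {n} → n < a → P n) → (∀ n → P (a ℕ.+ n)) → ∀ n → P n
q^-split P a below above n with n ℕ.<? a
... | yes n<a = below n<a
... | no  n≮a = ≡.subst P (ℕ.m+[n∸m]≡n (ℕ.≮⇒≥ n≮a)) (above (n ∸ a))

lambert-step : ∀ a n → lambert (suc a) n ≡ (q^ suc a ⊗ (q^ 0 ⊞ lambert (suc a))) n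
lambert-step a = q^-split (λ n → lambert (suc a) n ≡ (q^ suc a ⊗ (q^ 0 ⊞ lambert (suc a))) n) (suc a)
  (λ n<a → ≡.trans (lambert-< (suc a) n<a) (≡.sym (q^-⊗-< (suc a) (q^ 0 ⊞ lambert (suc a)) n<a)))
  (λ n → ≡.trans (periodic n) (≡.sym (q^-⊗-+ (suc a) (q^ 0 ⊞ lambert (suc a)) n)))
  where
  periodic : ∀ n → lambert (suc a) (suc a ℕ.+ n) ≡ (q^ 0 ⊞ lambert (suc a)) n
  -- At the index `suc a` itself the 1 comes from the summand `q^ 0`, the constant term of `lambert`
  -- being 0.
  periodic zero    = cong (if_then 1ℤ else 0ℤ)
    (dec-true (suc a ∣? suc (a ℕ.+ 0)) (≡.subst (suc a ∣_) (≡.sym (ℕ.+-identityʳ (suc a))) ∣-refl))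
  periodic (suc n) = ≡.trans
    (cong (if_then 1ℤ else 0ℤ) (does-⇔ (mk⇔ (λ a∣ → ∣m+n∣m⇒∣n a∣ ∣-refl) (∣m∣n⇒∣m+n ∣-refl))
      (suc a ∣? suc (a ℕ.+ suc n)) (suc a ∣? suc n)))
    (≡.sym (ℤ.+-identityˡ _))

D-q^ : ∀ a n → D (q^ a) n ≡ (const (+ a) ⊗ q^ a) n
D-q^ a n = ≡.trans lemma (≡.sym (const-⊗ (+ a) (q^ a) n))
  where
  lemma : + n ℤ.* (q^ a) n ≡ + a ℤ.* (q^ a) n
  lemma with a ℕ.≟ n
  ... | yes refl = refl
  ... | no  a≢n  = ≡.trans (cong (+ n ℤ.*_) vanishes) (≡.trans (ℤ.*-zeroʳ (+ n))
      (≡.sym (≡.trans (cong (+ a ℤ.*_) vanishes) (ℤ.*-zeroʳ (+ a)))))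
    where
    vanishes : (q^ a) n ≡ 0ℤ
    vanishes = cong (if_then 1ℤ else 0ℤ) (dec-false (a ℕ.≟ n) a≢n)

∑-extend : ∀ {m n} (f : ℕ → ℤ) → m ≤ n → (∀ i → m ≤ i → f i ≡ 0ℤ) → ∑[ i < m ] f (toℕ i) ≡ ∑[ i < n ] f (toℕ i)
∑-extend {n = n} f z≤n f≡0 = ≡.sym (ℤ∑.∑-zero {n} λ i → f≡0 (toℕ i) z≤n)
∑-extend f (s≤s m≤n) f≡0 = cong (λ x → f 0 ℤ.+ x) (∑-extend (f ∘ suc) m≤n λ i m≤i → f≡0 (suc i) (s≤s m≤i))

+-sum-applyUpTo : ∀ (h f : ℕ → ℕ) m → + sum (List.map h (applyUpTo f m)) ≡ ∑[ i < m ] (+ h (f (toℕ i)))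
+-sum-applyUpTo h f zero    = refl
+-sum-applyUpTo h f (suc m) = ≡.trans (ℤ.pos-+ (h (f 0)) _) (cong (λ x → + h (f 0) ℤ.+ x) (+-sum-applyUpTo h (f ∘ suc) m))

+-sum-divisors : ∀ (h f : ℕ → ℕ) n m →
  + sum (List.map h (filter (_∣? suc n) (applyUpTo f m))) ≡ ∑[ i < m ] (+ h (f (toℕ i)) ℤ.* lambert (f (toℕ i)) (suc n))
+-sum-divisors h f n zero    = refl
+-sum-divisors h f n (suc m) with does (f 0 ∣? suc n)
... | true  = ≡.trans (ℤ.pos-+ (h (f 0)) _)
  (cong₂ ℤ._+_ (≡.sym (ℤ.*-identityʳ (+ h (f 0)))) (+-sum-divisors h (f ∘ suc) n m))
... | false = ≡.trans (+-sum-divisors h (f ∘ suc) n m)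
  (≡.sym (≡.trans (cong (ℤ._+ ∑[ i < m ] (+ h (f (suc (toℕ i))) ℤ.* lambert (f (suc (toℕ i))) (suc n)))
    (ℤ.*-zeroʳ (+ h (f 0)))) (ℤ.+-identityˡ _)))

-- Divisors of n are at most n, so every cut-off N ≥ n gives the same sum. At n = 0 both sides are
-- 0: `σ-series` has no constant term.
σ-lambert : ∀ k {n N} → n ≤ N → σ-series k n ≡ ∑[ i < N ] (+ (suc (toℕ i) ℕ.^ k) ℤ.* lambert (suc (toℕ i)) n)
σ-lambert k {zero}  {N} n≤N = ≡.sym (ℤ∑.∑-zero {N} λ i → ℤ.*-zeroʳ (+ (suc (toℕ i) ℕ.^ k)))
σ-lambert k {suc n} n≤N = ≡.trans (+-sum-divisors (ℕ._^ k) suc n (suc n))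
  (∑-extend (λ i → + (suc i ℕ.^ k) ℤ.* lambert (suc i) (suc n)) n≤N λ i n<i → ≡.trans (cong (+ (suc i ℕ.^ k) ℤ.*_) (lambert-< (suc i) (s≤s n<i))) (ℤ.*-zeroʳ (+ (suc i ℕ.^ k))))

factor : ℕ → ℕ → PowerSeries
factor e m = (q^ 0 ⊟ q^ m) ↑ e

opaque
  unfolding _⊗_

  -- The two end terms of the convolution contain `f 0` or `g 0`, which leaves the range from 1 to
  -- n.
  ⊗-convolution : ∀ f g (h : ℕ → ℕ) n → f 0 ≡ 0ℤ → g 0 ≡ 0ℤ →
    (∀ i → + h i ≡ f i ℤ.* g (suc n ∸ i)) → (f ⊗ g) (suc n) ≡ + ∑[1⋯ n ] h
  ⊗-convolution f g h n f0 g0 h≡ = begin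
    (f ⊗ g) (suc n)
      ≡⟨ cong₂ ℤ._+_ (≡.trans (cong (ℤ._* g (suc n)) f0) (ℤ.*-zeroˡ (g (suc n))))
           (ℤ∑.∑-last n (λ i → f (suc i) ℤ.* g (n ∸ i))) ⟩
    0ℤ ℤ.+ (∑[ i < n ] (f (suc (toℕ i)) ℤ.* g (n ∸ toℕ i)) ℤ.+ f (suc n) ℤ.* g (n ∸ n))
      ≡⟨ ≡.trans (ℤ.+-identityˡ _) (cong₂ ℤ._+_
           (sum-cong-≗ {n} λ i → ≡.sym (h≡ (suc (toℕ i))))
           (≡.trans (cong (f (suc n) ℤ.*_) (≡.trans (cong g (ℕ.n∸n≡0 n)) g0)) (ℤ.*-zeroʳ (f (suc n))))) ⟩
    ∑[ i < n ] (+ h (suc (toℕ i))) ℤ.+ 0ℤ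
      ≡⟨ ℤ.+-identityʳ _ ⟩
    ∑[ i < n ] (+ h (suc (toℕ i)))
      ≡⟨ +-sum-applyUpTo h suc n ⟨
    + ∑[1⋯ n ] h ∎
    where open ≡-Reasoning

module Eisenstein (N : ℕ) where
  open Truncated N
  open CommutativeRing commutativeRing hiding (_≈_; trans; refl; sym; zero)
  open CommutativeRing commutativeRing using () renaming (trans to ≈-trans; refl to ≈-refl; sym to ≈-sym)
  open import Algebra.Properties.Semiring.Exp semiring using (_^_)
  open ℤ-Solver commutativeRing const-hom
  module R = RangeSums commutativeSemiring
  open R using (∑-cong)
  open Geometric commutativeSemiring
  open Derivation.Rules commutativeRing const-hom D D-cong D-+ D-leibniz D-const
  open import Relation.Binary.Reasoning.Setoid setoid

  -- Division by 1 - q^(suc a), in a form without division.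
  fixpoint-unique : ∀ {a u x y} → x ≈ u ⊞ q^ suc a ⊗ x → y ≈ u ⊞ q^ suc a ⊗ y → x ≈ y
  fixpoint-unique {a} {u} {x} {y} x≈ y≈ = coefficients λ {n} → <-rec (λ n → n < N → x n ≡ y n)
    (λ n rec n<N → ≡.trans (coefficient x≈ n<N) (≡.trans
      (cong (λ c → u n ℤ.+ c) (q^-split (λ n → (∀ {m} → m < n → m < N → x m ≡ y m) → n < N →
                          (q^ suc a ⊗ x) n ≡ (q^ suc a ⊗ y) n) (suc a)
        (λ n<a _ _ → ≡.trans (q^-⊗-< (suc a) x n<a) (≡.sym (q^-⊗-< (suc a) y n<a)))
        (λ m rec m<N → ≡.trans (q^-⊗-+ (suc a) x m) (≡.trans
          (rec (s≤s (ℕ.m≤n+m m a)) (ℕ.≤-<-trans (ℕ.m≤n+m m (suc a)) m<N))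
          (≡.sym (q^-⊗-+ (suc a) y m))))
        n rec n<N))
      (≡.sym (coefficient y≈ n<N)))) n

  w : ℕ → PowerSeries
  w i = lambert (suc i)

  ν : ℕ → PowerSeries
  ν i = const (+ suc i)

  w-step : ∀ i → w i ≈ q^ suc i ⊗ (q^ 0 ⊞ w i)
  w-step i = pointwise (lambert-step i)

  q^-+ : ∀ a b → q^ (a ℕ.+ b) ≈ q^ a ⊗ q^ b
  q^-+ a b = pointwise (q^-split (λ n → (q^ (a ℕ.+ b)) n ≡ (q^ a ⊗ q^ b) n) a
    (λ n<a → ≡.trans (vanishes n<a) (≡.sym (q^-⊗-< a (q^ b) n<a)))
    (λ n → ≡.trans (shift a n) (≡.sym (q^-⊗-+ a (q^ b) n))))
    where
    vanishes : ∀ {a n} → n < a → (q^ (a ℕ.+ b)) n ≡ 0ℤ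
    vanishes z<s               = refl
    vanishes (s<s n<a@(s≤s _)) = vanishes n<a
    shift : ∀ a n → (q^ (a ℕ.+ b)) (a ℕ.+ n) ≡ (q^ b) n
    shift zero    n = refl
    shift (suc a) n = shift a n

  q^-* : ∀ i k → q^ suc (suc (i ℕ.+ k)) ≈ q^ suc i ⊗ q^ suc k
  q^-* i k = ≈-trans (reflexive (cong (λ m → q^ suc m) (≡.sym (ℕ.+-suc i k)))) (q^-+ (suc i) (suc k))

  -- Both sides solve x = p t + p x for the `p` and `t` named below.
  w*w : ∀ i k → w i ⊗ w k ≈ w (suc (i ℕ.+ k)) ⊗ (w i ⊞ w k ⊞ q^ 0)
  w*w i k = fixpoint-unique {suc (i ℕ.+ k)} {p ⊗ t} {w i ⊗ w k} {w (suc (i ℕ.+ k)) ⊗ t}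
    (≈-trans (geometric-* {q^ suc i} {q^ suc k} {w i} {w k} (w-step i) (w-step k))
      (+-cong {q^ suc i ⊗ q^ suc k ⊗ t} {p ⊗ t} {q^ suc i ⊗ q^ suc k ⊗ (w i ⊗ w k)} {p ⊗ (w i ⊗ w k)}
        (*-congʳ {t} (≈-sym (q^-* i k))) (*-congʳ {w i ⊗ w k} (≈-sym (q^-* i k)))))
    (geometric-scale {p} {w (suc (i ℕ.+ k))} t (w-step (suc (i ℕ.+ k))))
    where
    p = q^ suc (suc (i ℕ.+ k))
    t = w i ⊞ w k ⊞ q^ 0

  w-vanishes : ∀ i → N ≤ i → w i ≈ const 0ℤ
  w-vanishes i N≤i = coefficients λ {n} n<N →
    ≡.trans (lambert-< (suc i) (ℕ.m≤n⇒m≤1+n (ℕ.≤-trans n<N N≤i))) (≡.sym (const-0 n))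

  D-w : ∀ i → D (w i) ≈ ν i ⊗ (w i ⊞ w i ⊗ w i)
  D-w i = fixpoint-unique {i} {ν i ⊗ w i} {D (w i)} {ν i ⊗ (w i ⊞ w i ⊗ w i)}
    (geometric-derivative {q^ suc i} {w i} {ν i} (pointwise (D-q^ (suc i))) (w-step i))
    (geometric-square {q^ suc i} {w i} (ν i) (w-step i))

  ν^ : ∀ i k → ν i ^ k ≈ const (+ (suc i ℕ.^ k))
  ν^ i zero    = pointwise q^0≗const
  ν^ i (suc k) = ≈-trans (*-congˡ {ν i} (ν^ i k))
    (≈-trans (≈-sym (const-* (+ suc i) (+ (suc i ℕ.^ k)))) (reflexive (cong const (≡.sym (ℤ.pos-* (suc i) (suc i ℕ.^ k))))))

  ∑-coefficient : ∀ {m} (f : Fin m → PowerSeries) n → (R.∑[ i < m ] f i) n ≡ ∑[ i < m ] f i n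
  ∑-coefficient {zero}  f n = const-0 n
  ∑-coefficient {suc m} f n = cong (λ x → f zero n ℤ.+ x) (∑-coefficient (f ∘ suc) n)

  σ-series≈ : ∀ k → σ-series k ≈ R.∑[ i < N ] (ν (toℕ i) ^ k ⊗ w (toℕ i))
  σ-series≈ k = ≈-trans
    (coefficients λ {n} n<N → ≡.trans (σ-lambert k (ℕ.<⇒≤ n<N)) (≡.sym (≡.trans
      (∑-coefficient {N} (λ i → const (+ (suc (toℕ i) ℕ.^ k)) ⊗ w (toℕ i)) n)
      (sum-cong-≗ {N} λ i → const-⊗ (+ (suc (toℕ i) ℕ.^ k)) (w (toℕ i)) n))))
    (∑-cong {N} λ i → *-congʳ {w (toℕ i)} (≈-sym (ν^ (toℕ i) k)))

  D-σ-series≈ : ∀ k → D (σ-series k) ≈ R.∑[ i < N ] (ν (toℕ i) ^ k ⊗ D (w (toℕ i)))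
  D-σ-series≈ k = ≈-trans (D-cong (σ-series≈ k)) (≈-trans (δ-∑ {N} (λ i → ν (toℕ i) ^ k ⊗ w (toℕ i)))
    (∑-cong {N} λ i → ≈-trans (D-cong (*-congʳ {w (toℕ i)} (ν^ (toℕ i) k)))
      (≈-trans (δ-κ* (+ (suc (toℕ i) ℕ.^ k)) (w (toℕ i))) (*-congʳ {D (w (toℕ i))} (≈-sym (ν^ (toℕ i) k))))))

  module M = Relations.LambertSeries commutativeRing const-hom N w (λ i → D (w i)) w*w w-vanishes D-w
    σ-series (λ k → D (σ-series k)) σ-series≈ D-σ-series≈
  open M using (E₂; E₄; E₆; E₈; E₁₂)

  D-E₄ : D E₄ ≈ const (+ 240) ⊗ D (σ-series 3)
  D-E₄ = δ-affine (+ 1) (+ 240) (σ-series 3)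

  D-E₈ : D E₈ ≈ const (+ 480) ⊗ D (σ-series 7)
  D-E₈ = δ-affine (+ 1) (+ 480) (σ-series 7)

  D-E₁₂ : D E₁₂ ≈ const (+ 65520) ⊗ D (σ-series 11)
  D-E₁₂ = δ-affine (+ 691) (+ 65520) (σ-series 11)

  ⊛≈⊗ : ∀ f g → f ⊛ g ≈ f ⊗ g
  ⊛≈⊗ f g = reflexive (⊛≡⊗ f g)

  ↑≡^ : ∀ f k → f ↑ k ≡ f ^ k
  ↑≡^ f zero    = refl
  ↑≡^ f (suc k) = ≡.trans (cong (f ⊛_) (↑≡^ f k)) (⊛≡⊗ f (f ^ k))

  D-factor : ∀ e i → D (factor e (suc i)) ≈ const (+ e) ⊗ ⊟ (ν i ⊗ w i) ⊗ factor e (suc i)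
  D-factor e i = ≡.subst (λ f → D f ≈ const (+ e) ⊗ ⊟ (ν i ⊗ w i) ⊗ f) (≡.sym (↑≡^ (q^ 0 ⊟ q^ suc i) e))
    (logarithmic-^ {q^ 0 ⊟ q^ suc i} {⊟ (ν i ⊗ w i)}
      (logarithmic-geometric {q^ suc i} {w i} {ν i} (pointwise (D-q^ (suc i))) (w-step i)) e)

  D-∏ : ∀ e m → D (∏[1⋯ m ] (factor e)) ≈ const (+ e) ⊗ ⊟ (R.∑[ i < m ] (ν (toℕ i) ⊗ w (toℕ i))) ⊗ ∏[1⋯ m ] (factor e)
  D-∏ e zero    = begin
    D (q^ 0)                                  ≈⟨ δ-1 ⟩
    const 0ℤ                                  ≈⟨ solve 2 (λ e o → # 0 := e :* :- # 0 :* o) ≈-refl (const (+ e)) (q^ 0) ⟩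
    const (+ e) ⊗ ⊟ const 0ℤ ⊗ q^ 0           ∎
  D-∏ e (suc m) = begin
    D (factor e (suc m) ⊛ Π)
      ≈⟨ D-cong (⊛≈⊗ (factor e (suc m)) Π) ⟩
    D (factor e (suc m) ⊗ Π)
      ≈⟨ logarithmic-* {factor e (suc m)} {Π} {const (+ e) ⊗ ⊟ t} {const (+ e) ⊗ ⊟ S} (D-factor e m) (D-∏ e m) ⟩
    (const (+ e) ⊗ ⊟ t ⊞ const (+ e) ⊗ ⊟ S) ⊗ (factor e (suc m) ⊗ Π)
      ≈⟨ *-congʳ {factor e (suc m) ⊗ Π} (solve 3 (λ e s t → e :* :- t :+ e :* :- s := e :* :- (s :+ t)) ≈-refl (const (+ e)) S t) ⟩
    const (+ e) ⊗ ⊟ (S ⊞ t) ⊗ (factor e (suc m) ⊗ Π)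
      ≈⟨ *-congʳ {factor e (suc m) ⊗ Π} (*-congˡ {const (+ e)} (-‿cong (R.∑-last m (λ i → ν i ⊗ w i)))) ⟨
    const (+ e) ⊗ ⊟ (R.∑[ i ≤ m ] (ν (toℕ i) ⊗ w (toℕ i))) ⊗ (factor e (suc m) ⊗ Π)
      ≈⟨ *-congˡ {const (+ e) ⊗ ⊟ (R.∑[ i ≤ m ] (ν (toℕ i) ⊗ w (toℕ i)))} (⊛≈⊗ (factor e (suc m)) Π) ⟨
    const (+ e) ⊗ ⊟ (R.∑[ i ≤ m ] (ν (toℕ i) ⊗ w (toℕ i))) ⊗ (factor e (suc m) ⊛ Π) ∎
    where
    Π = ∏[1⋯ m ] (factor e)
    S = R.∑[ i < m ] (ν (toℕ i) ⊗ w (toℕ i))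
    t = ν m ⊗ w m

  -- Once the lower coefficients vanish, the coefficient of q^n gives n U n = U n, so U n = 0 for n
  -- ≥ 2. At n = 1 this says nothing, hence the hypothesis on `U 1`.
  ode-unique : ∀ {P U} → P 0 ≡ 1ℤ → D U ≈ P ⊗ U → U 0 ≡ 0ℤ → U 1 ≡ 0ℤ → U ≈ const 0ℤ
  ode-unique {P} {U} P0 ode U0 U1 = coefficients λ {n} n<N →
    ≡.trans (<-rec (λ n → n < N → U n ≡ 0ℤ) step n n<N) (≡.sym (const-0 n))
    where
    step : ∀ n → (∀ {m} → m < n → m < N → U m ≡ 0ℤ) → n < N → U n ≡ 0ℤ
    step zero          rec n<N = U0
    step (suc zero)    rec n<N = U1
    step (suc (suc n)) rec n<N = ℤ.*-cancelˡ-≡ (+ suc n) u 0ℤ (≡.trans (ℤ-+-cancelˡ u (+ suc n ℤ.* u) 0ℤ (≡.trans (lemma (+ n) u) (≡.trans eq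
      (≡.sym (ℤ.+-identityʳ u))))) (≡.sym (ℤ.*-zeroʳ (+ suc n))))
      where
      u = U (suc (suc n))
      lemma : ∀ n u → u ℤ.+ (1ℤ ℤ.+ n) ℤ.* u ≡ (1ℤ ℤ.+ (1ℤ ℤ.+ n)) ℤ.* u
      lemma = ℤ-solve-∀
      eq : + suc (suc n) ℤ.* u ≡ u
      eq = ≡.trans (coefficient ode n<N) (≡.trans (≡.trans (⊗-suc P U (suc n)) (cong₂ ℤ._+_
        (≡.trans (cong (ℤ._* u) P0) (ℤ.*-identityˡ u))
        (⊗-zero (P ∘ suc) (suc n) λ i i≤1+n → rec (s≤s i≤1+n) (ℕ.<-trans (s≤s i≤1+n) n<N))))
        (ℤ.+-identityʳ u))

  -- Modulo q^N the factors beyond the N-th are 1; the finite product left over can be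
  -- differentiated factor by factor.
  q∏≈ : ∀ e → q^ 1 ⊗ ∏∞ (factor e) ≈ q^ 1 ⊗ ∏[1⋯ N ] (factor e)
  q∏≈ e = coefficients λ {n} n<N → ⊗-cong n {q^ 1} {q^ 1} (λ _ _ → refl)
    (λ i i≤n → ≡.sym (∏∞-stable (factor e)
      (λ m → ↑-≡1 {q^ 0 ⊟ q^ suc m} {suc m} (1-q^-≡1 (suc m)) e) (ℕ.≤-trans i≤n (ℕ.<⇒≤ n<N))))

  -- The 1 is the logarithmic derivative of the leading q. At e = 24 the multiplier becomes `E₂`.
  D-q∏ : ∀ e → D (q^ 1 ⊗ ∏∞ (factor e)) ≈ (const (+ 1) ⊞ ⊟ (const (+ e) ⊗ σ-series 1)) ⊗ (q^ 1 ⊗ ∏∞ (factor e))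
  D-q∏ e = begin
    D (q^ 1 ⊗ ∏∞ (factor e))
      ≈⟨ D-cong (q∏≈ e) ⟩
    D (q^ 1 ⊗ Π)
      ≈⟨ logarithmic-* {q^ 1} {Π} {const (+ 1)} {const (+ e) ⊗ ⊟ S} (pointwise (D-q^ 1)) (D-∏ e N) ⟩
    (const (+ 1) ⊞ const (+ e) ⊗ ⊟ S) ⊗ (q^ 1 ⊗ Π)
      ≈⟨ *-cong {const (+ 1) ⊞ const (+ e) ⊗ ⊟ S} {const (+ 1) ⊞ ⊟ (const (+ e) ⊗ S)} {q^ 1 ⊗ Π} {q^ 1 ⊗ ∏∞ (factor e)}
           (solve 2 (λ e s → # 1 :+ e :* :- s := # 1 :- e :* s) ≈-refl (const (+ e)) S) (≈-sym (q∏≈ e)) ⟩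
    (const (+ 1) ⊞ ⊟ (const (+ e) ⊗ S)) ⊗ (q^ 1 ⊗ ∏∞ (factor e))
      ≈⟨ *-congʳ {q^ 1 ⊗ ∏∞ (factor e)} (+-congˡ {const (+ 1)} (-‿cong (*-congˡ {const (+ e)} S≈))) ⟩
    (const (+ 1) ⊞ ⊟ (const (+ e) ⊗ σ-series 1)) ⊗ (q^ 1 ⊗ ∏∞ (factor e)) ∎
    where
    Π = ∏[1⋯ N ] (factor e)
    S = R.∑[ i < N ] (ν (toℕ i) ⊗ w (toℕ i))
    S≈ : S ≈ σ-series 1
    S≈ = ≈-trans (∑-cong {N} λ i → *-congʳ {w (toℕ i)} (≈-sym (*-identityʳ (ν (toℕ i))))) (≈-sym (σ-series≈ 1))

  D-τ : D τ ≈ E₂ ⊗ τ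
  D-τ = ≈-trans (D-cong (⊛≈⊗ (q^ 1) (∏∞ (factor 24)))) (≈-trans (D-q∏ 24) (*-congˡ {E₂} (≈-sym (⊛≈⊗ (q^ 1) (∏∞ (factor 24))))))

  δE₄ : const (+ 3) ⊗ D E₄ ≈ E₂ ⊗ E₄ ⊞ ⊟ E₆
  δE₄ = ≈-trans (*-congˡ {const (+ 3)} D-E₄) M.E₄-derivative

  δE₁₂ : D E₁₂ ≈ E₂ ⊗ E₁₂ ⊞ ⊟ (const (+ 691) ⊗ (E₆ ⊗ E₈))
  δE₁₂ = ≈-trans D-E₁₂ M.E₁₂-derivative

  open Discrepancy {E₂} {E₄} {E₆} {E₈} {E₁₂} {τ} δE₄ M.E₈≈E₄² δE₁₂ D-τ

  opaque
    unfolding _⊗_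

    E₂-0 : E₂ 0 ≡ 1ℤ
    E₂-0 = refl

    discrepancy-0 : discrepancy 0 ≡ 0ℤ
    discrepancy-0 = refl

    -- By evaluation: 691 (240 + 480) - 65520 - 432000 τ(1) = 0, with τ(1) = 1.
    discrepancy-1 : discrepancy 1 ≡ 0ℤ
    discrepancy-1 = refl

  discrepancy≈0 : discrepancy ≈ const 0ℤ
  discrepancy≈0 = ode-unique {E₂} {discrepancy} E₂-0 discrepancy-ode discrepancy-0 discrepancy-1

  E₄≈ : E₄ ≈ const (+ 1) ⊞ const (+ 240) ⊗ σ-series 3
  E₄≈ = ≈-refl

  E₈≈ : E₈ ≈ const (+ 1) ⊞ const (+ 480) ⊗ σ-series 7
  E₈≈ = ≈-refl

  identity₃ :
    const (+ 720) ⊗ (const (+ 691) ⊗ (D (σ-series 3) ⊞ const (+ 480) ⊗ (D (σ-series 3) ⊗ σ-series 7))) ≈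
    const (+ 720) ⊗ (const (+ 91) ⊗ D (σ-series 11) ⊞ const (+ 600) ⊗ D τ)
  identity₃ = series-identity₃ discrepancy≈0 {σ-series 3} {σ-series 7} {D (σ-series 3)} {D (σ-series 7)} {D (σ-series 11)}
    E₄≈ E₈≈ D-E₄ D-E₈ D-E₁₂

  identity₇ :
    const (+ 1440) ⊗ (const (+ 691) ⊗ (D (σ-series 7) ⊞ const (+ 240) ⊗ (σ-series 3 ⊗ D (σ-series 7)))) ≈
    const (+ 1440) ⊗ (const (+ 91) ⊗ D (σ-series 11) ⊞ const (+ 600) ⊗ D τ)
  identity₇ = series-identity₇ discrepancy≈0 {σ-series 3} {σ-series 7} {D (σ-series 3)} {D (σ-series 7)} {D (σ-series 11)}
    E₄≈ E₈≈ D-E₄ D-E₈ D-E₁₂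

-- Comparing coefficients in ℤ

const-⊗-const-⊗ : ∀ a b f g h n → (const a ⊗ (f ⊞ const b ⊗ (g ⊗ h))) n ≡ a ℤ.* (f n ℤ.+ b ℤ.* (g ⊗ h) n)
const-⊗-const-⊗ a b f g h n = ≡.trans (const-⊗ a _ n) (cong (λ x → a ℤ.* (f n ℤ.+ x)) (const-⊗ b (g ⊗ h) n))

module _ (n : ℕ) where

  open Truncated (suc n) using (_≈_; coefficient)

  -- Working modulo q^(n+1) suffices to read off the coefficient of q^n, and in ℤ the common factor
  -- `a`, 720 or 1440, can at last be cancelled.
  coefficient-identity : ∀ a .{{_ : ℤ.NonZero a}} b f g h →
    const a ⊗ (const (+ 691) ⊗ (f ⊞ const b ⊗ (g ⊗ h))) ≈ const a ⊗ (const (+ 91) ⊗ D (σ-series 11) ⊞ const (+ 600) ⊗ D τ) →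
    + 691 ℤ.* (f n ℤ.+ b ℤ.* (g ⊗ h) n) ≡ + 91 ℤ.* (+ n ℤ.* + σ 11 n) ℤ.+ + 600 ℤ.* (+ n ℤ.* τ n)
  coefficient-identity a b f g h eq = begin
    + 691 ℤ.* (f n ℤ.+ b ℤ.* (g ⊗ h) n)
      ≡⟨ const-⊗-const-⊗ (+ 691) b f g h n ⟨
    (const (+ 691) ⊗ (f ⊞ const b ⊗ (g ⊗ h))) n
      ≡⟨ ℤ.*-cancelˡ-≡ a _ _ (≡.trans (≡.sym (const-⊗ a _ n)) (≡.trans (coefficient eq ℕ.≤-refl) (const-⊗ a _ n))) ⟩
    (const (+ 91) ⊗ D (σ-series 11)) n ℤ.+ (const (+ 600) ⊗ D τ) n
      ≡⟨ cong₂ ℤ._+_ (const-⊗ (+ 91) (D (σ-series 11)) n) (const-⊗ (+ 600) (D τ) n) ⟩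
    + 91 ℤ.* (+ n ℤ.* + σ 11 n) ℤ.+ + 600 ℤ.* (+ n ℤ.* τ n) ∎
    where open ≡-Reasoning

ℤ-identity₃ : ∀ n .{{_ : NonZero n}} →
  + 691 ℤ.* (+ n ℤ.* + σ 3 n ℤ.+ + 480 ℤ.* + ∑[1⋯ n ∸ 1 ] (λ m → m ℕ.* σ 3 m ℕ.* σ 7 (n ∸ m))) ≡
  + 91 ℤ.* (+ n ℤ.* + σ 11 n) ℤ.+ + 600 ℤ.* (+ n ℤ.* τ n)
ℤ-identity₃ (suc n) = ≡.trans
  (cong (λ x → + 691 ℤ.* (+ suc n ℤ.* + σ 3 (suc n) ℤ.+ + 480 ℤ.* x)) (≡.sym
    (⊗-convolution (D (σ-series 3)) (σ-series 7) (λ m → m ℕ.* σ 3 m ℕ.* σ 7 (suc n ∸ m)) n refl refl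
      λ m → ≡.trans (ℤ.pos-* (m ℕ.* σ 3 m) (σ 7 (suc n ∸ m))) (cong (ℤ._* + σ 7 (suc n ∸ m)) (ℤ.pos-* m (σ 3 m))))))
  (coefficient-identity (suc n) (+ 720) (+ 480) (D (σ-series 3)) (D (σ-series 3)) (σ-series 7) (Eisenstein.identity₃ (suc (suc n))))

ℤ-identity₇ : ∀ n .{{_ : NonZero n}} →
  + 691 ℤ.* (+ n ℤ.* + σ 7 n ℤ.+ + 240 ℤ.* + ∑[1⋯ n ∸ 1 ] (λ m → (n ∸ m) ℕ.* σ 3 m ℕ.* σ 7 (n ∸ m))) ≡
  + 91 ℤ.* (+ n ℤ.* + σ 11 n) ℤ.+ + 600 ℤ.* (+ n ℤ.* τ n)
ℤ-identity₇ (suc n) = ≡.trans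
  (cong (λ x → + 691 ℤ.* (+ suc n ℤ.* + σ 7 (suc n) ℤ.+ + 240 ℤ.* x)) (≡.sym
    (⊗-convolution (σ-series 3) (D (σ-series 7)) (λ m → (suc n ∸ m) ℕ.* σ 3 m ℕ.* σ 7 (suc n ∸ m)) n refl refl
      λ m → ≡.trans (cong +_ (lemma (suc n ∸ m) (σ 3 m) (σ 7 (suc n ∸ m))))
        (≡.trans (ℤ.pos-* (σ 3 m) ((suc n ∸ m) ℕ.* σ 7 (suc n ∸ m))) (cong (+ σ 3 m ℤ.*_) (ℤ.pos-* (suc n ∸ m) (σ 7 (suc n ∸ m))))))))
  (coefficient-identity (suc n) (+ 1440) (+ 240) (D (σ-series 7)) (σ-series 3) (D (σ-series 7)) (Eisenstein.identity₇ (suc (suc n))))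
  where
  lemma : ∀ x y z → x ℕ.* y ℕ.* z ≡ y ℕ.* (x ℕ.* z)
  lemma x y z = ≡.trans (cong (ℕ._* z) (ℕ.*-comm x y)) (ℕ.*-assoc y x z)

-- Passage to the rationals

open import Data.Rational.Base as ℚ using (ℚ; _/_; _+_; _*_; -_)
import Data.Rational.Properties as ℚ
open import Data.Rational.Unnormalised.Base as ℚᵘ using (mkℚᵘ; *≡*)
import Data.Rational.Unnormalised.Properties as ℚᵘ

-- Elements of `ℚ` are in lowest terms; over the unnormalised rationals their equations become
-- integer identities.
toℚᵘ-ℤ→ℚ : ∀ i → ℚ.toℚᵘ (ℤ→ℚ i) ℚᵘ.≃ mkℚᵘ i 0
toℚᵘ-ℤ→ℚ i = ℚ.toℚᵘ-fromℚᵘ (mkℚᵘ i 0)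

ℤ→ℚ-+ : ∀ i j → ℤ→ℚ (i ℤ.+ j) ≡ ℤ→ℚ i + ℤ→ℚ j
ℤ→ℚ-+ i j = ℚ.toℚᵘ-injective (begin
  ℚ.toℚᵘ (ℤ→ℚ (i ℤ.+ j))                    ≈⟨ toℚᵘ-ℤ→ℚ (i ℤ.+ j) ⟩
  mkℚᵘ (i ℤ.+ j) 0                          ≈⟨ *≡* (lemma i j) ⟩
  mkℚᵘ i 0 ℚᵘ.+ mkℚᵘ j 0                    ≈⟨ ℚᵘ.+-cong (toℚᵘ-ℤ→ℚ i) (toℚᵘ-ℤ→ℚ j) ⟨
  ℚ.toℚᵘ (ℤ→ℚ i) ℚᵘ.+ ℚ.toℚᵘ (ℤ→ℚ j)        ≈⟨ ℚ.toℚᵘ-homo-+ (ℤ→ℚ i) (ℤ→ℚ j) ⟨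
  ℚ.toℚᵘ (ℤ→ℚ i + ℤ→ℚ j)                    ∎)
  where
  open import Relation.Binary.Reasoning.Setoid ℚᵘ.≃-setoid
  lemma : ∀ i j → (i ℤ.+ j) ℤ.* 1ℤ ≡ (i ℤ.* 1ℤ ℤ.+ j ℤ.* 1ℤ) ℤ.* 1ℤ
  lemma = ℤ-solve-∀

ℤ→ℚ-* : ∀ i j → ℤ→ℚ (i ℤ.* j) ≡ ℤ→ℚ i * ℤ→ℚ j
ℤ→ℚ-* i j = ℚ.toℚᵘ-injective (begin
  ℚ.toℚᵘ (ℤ→ℚ (i ℤ.* j))                    ≈⟨ toℚᵘ-ℤ→ℚ (i ℤ.* j) ⟩
  mkℚᵘ i 0 ℚᵘ.* mkℚᵘ j 0                    ≈⟨ ℚᵘ.*-cong (toℚᵘ-ℤ→ℚ i) (toℚᵘ-ℤ→ℚ j) ⟨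
  ℚ.toℚᵘ (ℤ→ℚ i) ℚᵘ.* ℚ.toℚᵘ (ℤ→ℚ j)        ≈⟨ ℚ.toℚᵘ-homo-* (ℤ→ℚ i) (ℤ→ℚ j) ⟨
  ℚ.toℚᵘ (ℤ→ℚ i * ℤ→ℚ j)                    ∎)
  where open import Relation.Binary.Reasoning.Setoid ℚᵘ.≃-setoid

ℤ→ℚ-neg : ∀ i → ℤ→ℚ (ℤ.- i) ≡ - ℤ→ℚ i
ℤ→ℚ-neg i = ℚ.toℚᵘ-injective (begin
  ℚ.toℚᵘ (ℤ→ℚ (ℤ.- i))     ≈⟨ toℚᵘ-ℤ→ℚ (ℤ.- i) ⟩
  ℚᵘ.- mkℚᵘ i 0            ≈⟨ ℚᵘ.-‿cong (toℚᵘ-ℤ→ℚ i) ⟨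
  ℚᵘ.- ℚ.toℚᵘ (ℤ→ℚ i)      ≈⟨ ℚ.toℚᵘ-homo‿- (ℤ→ℚ i) ⟨
  ℚ.toℚᵘ (- ℤ→ℚ i)         ∎)
  where open import Relation.Binary.Reasoning.Setoid ℚᵘ.≃-setoid

ℤ→ℚ-hom : ℤ-rawRing -Raw-AlmostCommutative⟶ fromCommutativeRing ℚ.+-*-commutativeRing
ℤ→ℚ-hom = record
  { ⟦_⟧    = ℤ→ℚ
  ; +-homo = ℤ→ℚ-+
  ; *-homo = ℤ→ℚ-*
  ; -‿homo = ℤ→ℚ-neg
  ; 0-homo = refl
  ; 1-homo = refl
  }

/-*-cancel : ∀ i d .{{_ : NonZero d}} → i / d * ℕ→ℚ d ≡ ℤ→ℚ i
/-*-cancel i (suc d) = ℚ.toℚᵘ-injective (begin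
  ℚ.toℚᵘ (i / suc d * ℕ→ℚ (suc d))                    ≈⟨ ℚ.toℚᵘ-homo-* (i / suc d) (ℕ→ℚ (suc d)) ⟩
  ℚ.toℚᵘ (i / suc d) ℚᵘ.* ℚ.toℚᵘ (ℕ→ℚ (suc d))        ≈⟨ ℚᵘ.*-cong (ℚ.toℚᵘ-fromℚᵘ (mkℚᵘ i d)) (toℚᵘ-ℤ→ℚ (+ suc d)) ⟩
  mkℚᵘ i d ℚᵘ.* mkℚᵘ (+ suc d) 0                       ≈⟨ *≡* (ℤ.*-assoc i (+ suc d) 1ℤ) ⟩
  mkℚᵘ i 0                                            ≈⟨ toℚᵘ-ℤ→ℚ i ⟨
  ℚ.toℚᵘ (ℤ→ℚ i)                                      ∎)
  where open import Relation.Binary.Reasoning.Setoid ℚᵘ.≃-setoid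

*-cancelˡ-ℕ→ℚ : ∀ d .{{_ : NonZero d}} {x y} → ℕ→ℚ d * x ≡ ℕ→ℚ d * y → x ≡ y
*-cancelˡ-ℕ→ℚ d {x} {y} dx≡dy = ≡.trans (≡.sym (scale x)) (≡.trans (cong ((+ 1 / d) *_) dx≡dy) (scale y))
  where
  scale : ∀ z → (+ 1 / d) * (ℕ→ℚ d * z) ≡ z
  scale z = ≡.trans (≡.sym (ℚ.*-assoc (+ 1 / d) (ℕ→ℚ d) z))
    (≡.trans (cong (_* z) (/-*-cancel (+ 1) d)) (ℚ.*-identityˡ z))

divide-by-600n : ∀ n .{{_ : NonZero n}} .{{_ : NonZero (5 ℕ.* n)}} c t x y z →
  + 691 ℤ.* (+ n ℤ.* + y ℤ.+ + c ℤ.* + z) ≡ + 91 ℤ.* (+ n ℤ.* + x) ℤ.+ + 600 ℤ.* (+ n ℤ.* t) →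
  ∀ {k} → 120 ℕ.* k ≡ 691 ℕ.* c →
  ℤ→ℚ t ≡ - (+ 91 / 600) * ℕ→ℚ x + (+ 691 / 600) * ℕ→ℚ y + (+ k / (5 ℕ.* n)) * ℕ→ℚ z
divide-by-600n n c t x y z eq {k} 120k≡691c = *-cancelˡ-ℕ→ℚ (600 ℕ.* n) {{ℕ.m*n≢0 600 n}} (begin
  ℕ→ℚ (600 ℕ.* n) * ℤ→ℚ t
    ≡⟨ cong (_* ℤ→ℚ t) 600n ⟩
  ℤ→ℚ (+ 600) * ℕ→ℚ n * ℤ→ℚ t
    ≡⟨ clear {+ 91} {+ 691} {+ k} {+ c} (+ 91 / 600) (+ 691 / 600) (+ k / (5 ℕ.* n)) (ℕ→ℚ n) (ℤ→ℚ t) (ℕ→ℚ x) (ℕ→ℚ y) (ℕ→ℚ z)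
         (/-*-cancel (+ 91) 600) (/-*-cancel (+ 691) 600)
         (≡.trans (cong ((+ k / (5 ℕ.* n)) *_) (≡.sym (≡.trans (cong ℤ→ℚ (ℤ.pos-* 5 n)) (ℤ→ℚ-* (+ 5) (+ n))))) (/-*-cancel (+ k) (5 ℕ.* n)))
         ratio image ⟩
  ℤ→ℚ (+ 600) * ℕ→ℚ n * value
    ≡⟨ cong (_* value) 600n ⟨
  ℕ→ℚ (600 ℕ.* n) * value ∎)
  where
  open ≡-Reasoning
  open ClearDenominators ℚ.+-*-commutativeRing ℤ→ℚ-hom
  value = - (+ 91 / 600) * ℕ→ℚ x + (+ 691 / 600) * ℕ→ℚ y + (+ k / (5 ℕ.* n)) * ℕ→ℚ z
  600n : ℕ→ℚ (600 ℕ.* n) ≡ ℤ→ℚ (+ 600) * ℕ→ℚ n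
  600n = ≡.trans (cong ℤ→ℚ (ℤ.pos-* 600 n)) (ℤ→ℚ-* (+ 600) (+ n))
  image : ℤ→ℚ (+ 691) * (ℕ→ℚ n * ℕ→ℚ y + ℕ→ℚ c * ℕ→ℚ z) ≡ ℤ→ℚ (+ 91) * (ℕ→ℚ n * ℕ→ℚ x) + ℤ→ℚ (+ 600) * (ℕ→ℚ n * ℤ→ℚ t)
  image = begin
    ℤ→ℚ (+ 691) * (ℕ→ℚ n * ℕ→ℚ y + ℕ→ℚ c * ℕ→ℚ z)
      ≡⟨ ≡.trans (ℤ→ℚ-* (+ 691) (+ n ℤ.* + y ℤ.+ + c ℤ.* + z)) (cong (ℤ→ℚ (+ 691) *_) (≡.trans (ℤ→ℚ-+ (+ n ℤ.* + y) (+ c ℤ.* + z)) (cong₂ _+_ (ℤ→ℚ-* (+ n) (+ y)) (ℤ→ℚ-* (+ c) (+ z))))) ⟨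
    ℤ→ℚ (+ 691 ℤ.* (+ n ℤ.* + y ℤ.+ + c ℤ.* + z))
      ≡⟨ cong ℤ→ℚ eq ⟩
    ℤ→ℚ (+ 91 ℤ.* (+ n ℤ.* + x) ℤ.+ + 600 ℤ.* (+ n ℤ.* t))
      ≡⟨ ≡.trans (ℤ→ℚ-+ (+ 91 ℤ.* (+ n ℤ.* + x)) (+ 600 ℤ.* (+ n ℤ.* t))) (cong₂ _+_ (scale (+ 91) (+ n) (+ x)) (scale (+ 600) (+ n) t)) ⟩
    ℤ→ℚ (+ 91) * (ℕ→ℚ n * ℕ→ℚ x) + ℤ→ℚ (+ 600) * (ℕ→ℚ n * ℤ→ℚ t) ∎
    where
    scale : ∀ a i j → ℤ→ℚ (a ℤ.* (i ℤ.* j)) ≡ ℤ→ℚ a * (ℤ→ℚ i * ℤ→ℚ j)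
    scale a i j = ≡.trans (ℤ→ℚ-* a (i ℤ.* j)) (cong (ℤ→ℚ a *_) (ℤ→ℚ-* i j))
  ratio : ℤ→ℚ (+ 120) * ℤ→ℚ (+ k) ≡ ℤ→ℚ (+ 691) * ℕ→ℚ c
  ratio = begin
    ℤ→ℚ (+ 120) * ℤ→ℚ (+ k)    ≡⟨ ≡.trans (cong ℤ→ℚ (ℤ.pos-* 120 k)) (ℤ→ℚ-* (+ 120) (+ k)) ⟨
    ℕ→ℚ (120 ℕ.* k)            ≡⟨ cong ℕ→ℚ 120k≡691c ⟩
    ℕ→ℚ (691 ℕ.* c)            ≡⟨ ≡.trans (cong ℤ→ℚ (ℤ.pos-* 691 c)) (ℤ→ℚ-* (+ 691) (+ c)) ⟩
    ℤ→ℚ (+ 691) * ℕ→ℚ c        ∎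

theorem2p4 : ∀ (n : ℕ) .{{_ : NonZero n}} →
    let instance 5n≢0 = m*n≢0 5 n in
    (ℤ→ℚ (τ n) ≡ - (ℤ.+ 91 / 600) * ℕ→ℚ (σ 11 n) + (ℤ.+ 691 / 600) * ℕ→ℚ (σ 3 n)
    + (ℤ.+ (4 ℕ.* 691) / (5 ℕ.* n)) * ℕ→ℚ (∑[1⋯ n ∸ 1 ] (λ m → m ℕ.* σ 3 m ℕ.* σ 7 (n ∸ m))))
    ×
    (ℤ→ℚ (τ n) ≡ - (ℤ.+ 91 / 600) * ℕ→ℚ (σ 11 n) + (ℤ.+ 691 / 600) * ℕ→ℚ (σ 7 n)
    + (ℤ.+ (2 ℕ.* 691) / (5 ℕ.* n)) * ℕ→ℚ (∑[1⋯ n ∸ 1 ] (λ m → (n ∸ m) ℕ.* σ 3 m ℕ.* σ 7 (n ∸ m))))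
theorem2p4 n {{n≢0}} =
  -- The convolution enters with coefficient 480 in (i) and 240 in (ii), from E₈ and E₄; `refl`
  -- checks 120 · 4 · 691 = 691 · 480 and, below, 120 · 2 · 691 = 691 · 240.
  divide-by-600n n {{n≢0}} {{m*n≢0 5 n}} 480 (τ n) (σ 11 n) (σ 3 n)
    (∑[1⋯ n ∸ 1 ] (λ m → m ℕ.* σ 3 m ℕ.* σ 7 (n ∸ m))) (ℤ-identity₃ n) {4 ℕ.* 691} refl ,
  divide-by-600n n {{n≢0}} {{m*n≢0 5 n}} 240 (τ n) (σ 11 n) (σ 7 n)
    (∑[1⋯ n ∸ 1 ] (λ m → (n ∸ m) ℕ.* σ 3 m ℕ.* σ 7 (n ∸ m))) (ℤ-identity₇ n) {2 ℕ.* 691} refl
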